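{- Let $d\ge2$ be even and $k\ge1$. Let $\delta=\delta_{d,k}\in\bigvee^k(\mathbb C^k)^{\otimes d}$ be Cayley's first hyperdeterminant $$\delta=\frac1{k!}\sum_{\pi_1,\dots,\pi_d\in S_k}\mathrm{sgn}(\pi_1)\cdots\mathrm{sgn}(\pi_d)\,\prod_{i=1}^ke_{\pi_1(i),\dots,\pi_d(i)}.$$ Then for every $n\ge1$, $$\delta^n=\sum_{S\in A^{\mathrm{lex}}((k\times n)^d)}\Delta_S(\mathsf I_n)\,\textstyle\bigvee e_S,$$ where for each $S$ the polynomial $\Delta_S$ is taken in $\bigvee(\mathbb C^n)^{\otimes d}$. In particular, the coefficient of $\delta^{k^{d-1}}$ at the monomial $\bigvee e_{[k]^d}=\prod_{\mathbf i\in[k]^d}e_{\mathbf i}$ equals $\pm\mathrm{AT}_d(k)$.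
   Context: For $N\ge1$, $\bigvee(\mathbb C^N)^{\otimes d}$ is the polynomial ring in commuting variables $e_{\mathbf i}$, $\mathbf i\in[N]^d$. $k\times n$ denotes the partition $(n,n,\dots,n)$ with $k$ parts, and $(k\times n)^d$ the $d$-tuple of copies of it. For a sequence $\alpha$ with sum $m$, $A(\alpha)$ is the set of words of length $m$ in which letter $i$ occurs $\alpha_i$ times; $A(\pmb\alpha)=A(\alpha^{(1)})\times\cdots\times A(\alpha^{(d)})$ is viewed as $d\times m$ tables with columns $S(1),\dots,S(m)$; $A^{\mathrm{lex}}(\pmb\alpha)$ consists of those with lexicographically weakly increasing columns. $\bigvee e_S=e_{S(1)}\cdots e_{S(m)}$. $\|T\|=\prod_{\mathbf c}(\#\{j:T(j)=\mathbf c\})!$. Signs: $(-1)^w=(-1)^{\#\{i<j:w_i>w_j\}}$; $(-1)^T=\prod_i(-1)^{t_i}$ over rows $t_i$. For words $s,x$ of length $m$, $\mathrm{sgn}_s(x)=\prod_c\mathrm{sgn}(x_{b_1},\dots,x_{b_r})$ over letters $c$ of $s$ with positions $b_1<\dots<b_r$, where $\mathrm{sgn}(a_1,\dots,a_r)$ is the permutation sign if $(a_1,\dots,a_r)$ is a permutation of $[r]$ and $0$ otherwise; $\mathrm{sgn}_T(X)=\prod_i\mathrm{sgn}_{t_i}(x_i)$. For a $d\times m$ table $T$ of positive integers, $\Delta_T=\frac{(-1)^T}{\|T\|}\sum_X\mathrm{sgn}_T(X)\bigvee e_X\in\bigvee(\mathbb C^n)^{\otimes d}$, the sum over all $d\times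 m$ tables $X$ with entries in $[n]$. $\Delta_S(\mathsf I_n)$ denotes the value of the polynomial $\Delta_S$ at the unit tensor $\mathsf I_n=\sum_{i=1}^ne_i\otimes\cdots\otimes e_i$, i.e. after substituting $e_{\mathbf i}\mapsto1$ if $i_1=\dots=i_d$ and $e_{\mathbf i}\mapsto0$ otherwise. Latin hypercubes: a $d$-dimensional Latin hypercube of order $k$ is a map $L:[k]^d\to[k^{d-1}]$ such that for every direction $\ell\in[d]$ and $j\in[k]$, the restriction of $L$ to the slice $\{\mathbf i:i_\ell=j\}$ (which has $k^{d-1}$ cells) is a bijection onto $[k^{d-1}]$. Its sign $\mathrm{sgn}(L)$ is the product over all $dk$ slices of the signs of the permutations obtained by reading $L$ on the slice in lexicographic order of cells. $\mathrm{AT}_d(k)=\sum_L\mathrm{sgn}(L)$ over all such $L$. -}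

module Defs where

open import Data.Nat as ℕ using (ℕ; zero; suc; _<ᵇ_; _≡ᵇ_; _!; _^_; _∸_)
open import Data.Integer as ℤ using (ℤ; +_)
open import Data.Rational as ℚ using (ℚ; 0ℚ; 1ℚ; _/_)
open import Data.Fin using (Fin; toℕ)
open import Data.Fin.Properties using () renaming (_≟_ to _≟F_)
open import Data.Vec as Vec using (Vec; []; _∷_; lookup)
open import Data.Vec.Properties using (≡-dec)
open import Data.List as List using (List; []; _∷_; _++_; map; concatMap; filter; length; foldr; allFin; upTo; zip)
open import Data.Bool using (Bool; true; false; if_then_else_; _∧_; not)
open import Data.Product using (_×_; _,_; proj₁; proj₂)
open import Relation.Nullary.Decidable using (⌊_⌋)

-- all vectors of length n with entries from the list xs (lexicographic
-- order when xs is increasing)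
allVecs : {A : Set} → List A → (n : ℕ) → List (Vec A n)
allVecs xs zero = [] ∷ []
allVecs xs (suc n) = concatMap (λ a → map (a ∷_) (allVecs xs n)) xs

allLists : {A : Set} → List A → ℕ → List (List A)
allLists xs zero = [] ∷ []
allLists xs (suc n) = concatMap (λ a → map (a ∷_) (allLists xs n)) xs

sumℚ : List ℚ → ℚ
sumℚ = foldr ℚ._+_ 0ℚ

prodℚ : List ℚ → ℚ
prodℚ = foldr ℚ._*_ 1ℚ

prodℤ : List ℤ → ℤ
prodℤ = foldr ℤ._*_ (+ 1)

allB : {A : Set} → (A → Bool) → List A → Bool
allB p = foldr (λ a b → p a ∧ b) true

countB : {A : Set} → (A → Bool) → List A → ℕ
countB p xs = length (List.filterᵇ p xs)

ℤtoℚ : ℤ → ℚ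
ℤtoℚ z = z / 1

-- 1/m for m ≥ 1 (only ever applied to factorials, which are ≥ 1)
recipℕ : ℕ → ℚ
recipℕ zero = 0ℚ
recipℕ (suc m) = + 1 / suc m

inversions : List ℕ → ℕ
inversions [] = 0
inversions (a ∷ w) = countB (λ b → b <ᵇ a) w ℕ.+ inversions w

signW : List ℕ → ℤ
signW w = (ℤ.- (+ 1)) ℤ.^ inversions w

isPerm : List ℕ → Bool
isPerm w = allB (λ j → countB (λ b → b ≡ᵇ j) w ≡ᵇ 1) (upTo (length w))

psgn : List ℕ → ℤ
psgn w = if isPerm w then signW w else + 0

-- Columns, monomials, formal sums (polynomials) in ⋁(ℂ^N)^{⊗d}
-- A variable e_𝐢, 𝐢 ∈ [N]^d, is a column  Vec (Fin N) d  (0-based).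
-- A monomial is a finite multiset of variables, given as a list.

Col : ℕ → ℕ → Set
Col N d = Vec (Fin N) d

eqCol : {N d : ℕ} → Col N d → Col N d → Bool
eqCol v w = ⌊ ≡-dec _≟F_ v w ⌋

Monomial : ℕ → ℕ → Set
Monomial N d = List (Col N d)

-- multiset equality of monomials (commutativity of the variables)
sameMon : {N d : ℕ} → Monomial N d → Monomial N d → Bool
sameMon M M' = allB (λ v → countB (eqCol v) M ≡ᵇ countB (eqCol v) M') (M ++ M')

Poly : ℕ → ℕ → Set
Poly N d = List (ℚ × Monomial N d)

coeff : {N d : ℕ} → Poly N d → Monomial N d → ℚ
coeff p M = sumℚ (map (λ t → if sameMon (proj₂ t) M then proj₁ t else 0ℚ) p)

_*P_ : {N d : ℕ} → Poly N d → Poly N d → Poly N d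
p *P q = concatMap (λ s → map (λ t → (proj₁ s ℚ.* proj₁ t , proj₂ s ++ proj₂ t)) q) p

_^P_ : {N d : ℕ} → Poly N d → ℕ → Poly N d
p ^P zero = (1ℚ , []) ∷ []
p ^P suc n = p *P (p ^P n)

-- value at the unit tensor I_N : e_𝐢 ↦ 1 if i_1 = … = i_d, else 0
isDiag : {N d : ℕ} → Col N d → Bool
isDiag [] = true
isDiag (a ∷ v) = allB (λ b → ⌊ a ≟F b ⌋) (Vec.toList v)

evalUnit : {N d : ℕ} → Poly N d → ℚ
evalUnit p = sumℚ (map (λ t → proj₁ t ℚ.* prodℚ (map (λ v → if isDiag v then 1ℚ else 0ℚ) (proj₂ t))) p)

finsToℕ : {k : ℕ} → List (Fin k) → List ℕ
finsToℕ = map toℕ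

perms : (k : ℕ) → List (Vec (Fin k) k)
perms k = List.filterᵇ (λ π → isPerm (finsToℕ (Vec.toList π))) (allVecs (allFin k) k)

permSign : {k : ℕ} → Vec (Fin k) k → ℤ
permSign π = signW (finsToℕ (Vec.toList π))

hyperdet : (d k : ℕ) → Poly k d
hyperdet d k = map term (allVecs (perms k) d)
  where
  term : Vec (Vec (Fin k) k) d → ℚ × Monomial k d
  term πs = ( ℤtoℚ (prodℤ (map permSign (Vec.toList πs))) ℚ.* recipℕ (k !)
            , map (λ i → Vec.map (λ π → lookup π i) πs) (allFin k) )

-- Tables: a d×m table with entries in [N] is the list of its m columns
-- S(1),…,S(m), each a Col N d.  Row t_i = (S(1)_i, …, S(m)_i).

Table : ℕ → ℕ → Set
Table N d = List (Col N d)

row : {N d : ℕ} → Table N d → Fin d → List (Fin N)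
row T i = map (λ c → lookup c i) T

lexLeqℕ : List ℕ → List ℕ → Bool
lexLeqℕ [] _ = true
lexLeqℕ (_ ∷ _) [] = false
lexLeqℕ (a ∷ v) (b ∷ w) = (a <ᵇ b) Data.Bool.∨ ((a ≡ᵇ b) ∧ lexLeqℕ v w)

lexLeq : {N d : ℕ} → Col N d → Col N d → Bool
lexLeq v w = lexLeqℕ (finsToℕ (Vec.toList v)) (finsToℕ (Vec.toList w))

lexSorted : {N d : ℕ} → Table N d → Bool
lexSorted [] = true
lexSorted (c ∷ []) = true
lexSorted (c ∷ c′ ∷ T) = lexLeq c c′ ∧ lexSorted (c′ ∷ T)

Alex : (d k n : ℕ) → List (Table k d)
Alex d k n = List.filterᵇ ok (allLists (allVecs (allFin k) d) (k ℕ.* n))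
  where
  ok : Table k d → Bool
  ok T = allB (λ i → allB (λ c → countB (λ x → ⌊ x ≟F c ⌋) (row T i) ≡ᵇ n) (allFin k)) (allFin d)
         ∧ lexSorted T

signT : {N d : ℕ} → Table N d → ℤ
signT {d = d} T = prodℤ (map (λ i → signW (finsToℕ (row T i))) (allFin d))

normT : {N d : ℕ} → Table N d → ℕ
normT {N} {d} T = foldr ℕ._*_ 1 (map (λ c → countB (eqCol c) T !) (allVecs (allFin N) d))

sgnWord : {k n : ℕ} → List (Fin k) → List (Fin n) → ℤ
sgnWord {k} s x = prodℤ (map (λ c → psgn (map (λ p → toℕ (proj₂ p))
                        (List.filterᵇ (λ p → ⌊ proj₁ p ≟F c ⌋) (zip s x)))) (allFin k))

sgnTable : {k n d : ℕ} → Table k d → Table n d → ℤ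
sgnTable {d = d} T X = prodℤ (map (λ i → sgnWord (row T i) (row X i)) (allFin d))

Delta : {k d : ℕ} → (n : ℕ) → Table k d → Poly n d
Delta {k} {d} n T = map (λ X → (ℤtoℚ (signT T ℤ.* sgnTable T X) ℚ.* recipℕ (normT T) , X))
                        (allLists (allVecs (allFin n) d) (length T))

rhsPoly : (d k n : ℕ) → Poly k d
rhsPoly d k n = map (λ S → (evalUnit (Delta n S) , S)) (Alex d k n)

fullMonomial : (k d : ℕ) → Monomial k d
fullMonomial k d = allVecs (allFin k) d

-- Latin hypercubes.  A map L : [k]^d → [k^{d-1}] is given by the list of
-- its values on the cells of [k]^d listed in lexicographic order
-- (allVecs (allFin k) d is lexicographic).

cells : (k d : ℕ) → List (Col k d)
cells k d = allVecs (allFin k) d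

slice : {k d K : ℕ} → List (Fin K) → Fin d → Fin k → List ℕ
slice {k} {d} L ℓ j = map (λ p → toℕ (proj₂ p)) (List.filterᵇ (λ p → ⌊ lookup (proj₁ p) ℓ ≟F j ⌋) (zip (cells k d) L))

allSlices : {k d K : ℕ} → List (Fin K) → List (List ℕ)
allSlices {k} {d} L = concatMap (λ ℓ → map (λ j → slice {k} {d} L ℓ j) (allFin k)) (allFin d)

isLatin : {k d K : ℕ} → List (Fin K) → Bool
isLatin {k} {d} L = allB isPerm (allSlices {k} {d} L)

sgnLatin : {k d K : ℕ} → List (Fin K) → ℤ
sgnLatin {k} {d} L = prodℤ (map signW (allSlices {k} {d} L))

AT : (d k : ℕ) → ℤ
AT d k = foldr ℤ._+_ (+ 0) (map (sgnLatin {k} {d} {K})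
           (List.filterᵇ (isLatin {k} {d} {K}) (allLists (allFin K) (length (cells k d)))))
  where K = k ^ (d ∸ 1)

{-# OPTIONS --safe #-}
module Submission where

-- For a monomial M, let D_M P be the value at 0 of the partial derivative of P with respect to
-- the variables in M, so that D_M P = ‖M‖ · coeff P M.  The Leibniz rule expands D_M (δⁿ) as a sum
-- over all ways x : M → [n] of distributing M over the n factors.  For even d, the row signs
-- F(Y) = ∏ᵢ sgn(rowᵢ Y) are symmetric in the columns of Y, which gives D_M δ = F(M), and therefore
--   ‖M‖ · coeff (δⁿ) M = ∑ₓ ∏ₚ F(M restricted to x = p).
-- On the other side only tables with constant columns survive at the unit tensor, so that
-- ‖S‖ · Δ_S(I_n) = ∑ₓ ∏ᵢ (-1)^{sᵢ} sgn_{sᵢ}(x).  The two sums agree term by term: sorting the cells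
-- (sᵢ, x) of the k×n grid row by row or column by column gives
--   (-1)^{sᵢ} sgn_{sᵢ}(x) = ε (-1)^x ∏ₚ sgn(sᵢ restricted to x = p),
-- where ε depends on k and n only, and (ε (-1)^x)^d = 1.

open import Defs
open import Level using (0ℓ)
open import Algebra.Bundles using (CommutativeMonoid)
open import Algebra.Structures using (IsCommutativeMonoid)
import Algebra.Properties.CommutativeSemigroup as CommutativeSemigroupProperties
open import Data.Nat as ℕ using (ℕ; zero; suc; _≤_; _^_; _∸_; _≡ᵇ_; _<ᵇ_; _!)
open import Data.Nat.Divisibility using (_∣_; divides)
import Data.Nat.Properties as ℕₚ
import Data.Nat.Tactic.RingSolver as ℕSolver
open import Data.Integer as ℤ using (ℤ; +_)
import Data.Integer.Properties as ℤₚ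
import Data.Integer.Tactic.RingSolver as ℤSolver
open import Data.Rational as ℚ using (ℚ; 0ℚ; 1ℚ; -_)
import Data.Rational.Properties as ℚₚ
open import Data.Rational.Unnormalised as ℚᵘ using (mkℚᵘ; *≡*)
import Data.Rational.Unnormalised.Properties as ℚᵘₚ
open import Data.Bool using (Bool; true; false; if_then_else_; _∧_; not)
import Data.Bool.Properties as Boolₚ
open import Data.Fin using (Fin; zero; suc; toℕ)
open import Data.Fin.Properties using (suc-injective; toℕ-injective; all?) renaming (_≟_ to _≟F_)
open import Data.Vec as Vec using (Vec; []; _∷_; lookup)
import Data.Vec.Properties as Vecₚ
open import Data.List as List using (List; []; _∷_; _++_; map; concatMap; length; foldr; allFin; upTo; zip)
import Data.List.Properties as Listₚ
import Data.List.Sort as Sort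
open import Data.List.Membership.Propositional using (_∈_)
open import Data.List.Membership.Propositional.Properties using (∈-map⁻; ∈-∃++; ∈-++⁺ˡ; ∈-++⁺ʳ; ∈-allFin)
open import Data.List.Relation.Binary.Equality.Propositional using (≋⇒≡)
open import Data.List.Relation.Binary.Permutation.Propositional using (_↭_; refl; prep; swap; trans; ↭-sym; ↭⇒↭ₛ)
open import Data.List.Relation.Binary.Permutation.Propositional.Properties using (drop-∷; shift; shifts; ++⁺ˡ; map⁺; ↭-length; ↭-empty-inv)
open import Data.List.Relation.Unary.Any using (here; there)
open import Data.List.Relation.Unary.Linked using (Linked; []; [-]; _∷_)
open import Data.List.Relation.Unary.Sorted.TotalOrder.Properties using (↗↭↗⇒≋)
open import Data.Product using (_×_; _,_; proj₁; proj₂; map₁; map₂)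
import Data.Product.Properties as ×ₚ
open import Data.Sum using (_⊎_; inj₁; inj₂)
open import Function using (_∘_; Equivalence)
open import Relation.Binary.Bundles using (DecTotalOrder)
open import Relation.Binary.Definitions using (DecidableEquality; tri<; tri≈; tri>)
open import Relation.Binary.PropositionalEquality as ≡ using (_≡_; _≢_; refl; sym; cong; cong₂; module ≡-Reasoning)
open import Relation.Nullary using (¬_; Dec; yes; no; contradiction; _×-dec_)
open import Relation.Nullary.Decidable using (⌊_⌋)

open ≡-Reasoning

-- Monomials are lists taken up to order, so coefficients mix the summation with the identification
-- of rearranged and repeated variables. Derivatives avoid this: `match` counts bijections of
-- positions, so repeated variables stay distinguishable and the Leibniz rule needs no multinomial
-- coefficients. The factor 1/k! of δ cancels in the same way: over all tables of k columns, `match`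
-- with a monomial M of degree k has total weight k!, and F equals F(M) wherever the weight is not
-- zero.
--
-- The sign ε is found without composing permutations. Every sign is a parity of inversions, and
-- inversions are sums over pairs of positions. A pair contributes an odd amount to the combined
-- count exactly when its two coordinates compare in opposite directions. This relation is
-- symmetric, so the number of such pairs depends only on the multiset of cells, which is the full
-- grid as soon as the signs do not vanish.
--
-- Words that are not permutations have sign zero. Hence the power has only monomials whose rows
-- contain each letter n times, and each of these has exactly one sorted arrangement on the
-- right-hand side.

private
  module ℕ+ = CommutativeSemigroupProperties (CommutativeMonoid.commutativeSemigroup ℕₚ.+-0-commutativeMonoid)
  module ℚ* = CommutativeSemigroupProperties (CommutativeMonoid.commutativeSemigroup ℚₚ.*-1-commutativeMonoid)

private variable
  A B E : Set

-- Finite sums and products over lists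

⌊⌋-refl : (_≟_ : DecidableEquality A) → ∀ a → ⌊ a ≟ a ⌋ ≡ true
⌊⌋-refl _≟_ a with a ≟ a
... | yes _ = refl
... | no a≢a = contradiction refl a≢a

⌊⌋-sym : (_≟_ : DecidableEquality A) → ∀ a b → ⌊ a ≟ b ⌋ ≡ ⌊ b ≟ a ⌋
⌊⌋-sym _≟_ a b with a ≟ b | b ≟ a
... | yes _ | yes _ = refl
... | no _ | no _ = refl
... | yes a≡b | no b≢a = contradiction (sym a≡b) b≢a
... | no a≢b | yes b≡a = contradiction (sym b≡a) a≢b

columns : {a b : ℕ} → Vec (Vec A a) b → Vec (Vec A b) a
columns [] = Vec.replicate _ []
columns (w ∷ W) = Vec.zipWith _∷_ w (columns W)

module BigOp {C : Set} {_∙_ : C → C → C} {ε : C} (isCM : IsCommutativeMonoid _≡_ _∙_ ε) where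

  open IsCommutativeMonoid isCM using (assoc; comm; identityˡ; identityʳ)

  -- The shape `foldr` after `map` is that of `sumℚ`, `prodℚ` and `prodℤ` applied to a mapped list,
  -- so the sums and products in the definitions are instances by computation.
  big : List A → (A → C) → C
  big xs f = foldr _∙_ ε (map f xs)

  private
    ∙-interchange : ∀ a b c d → (a ∙ b) ∙ (c ∙ d) ≡ (a ∙ c) ∙ (b ∙ d)
    ∙-interchange a b c d = begin
      (a ∙ b) ∙ (c ∙ d)  ≡⟨ assoc a b (c ∙ d) ⟩
      a ∙ (b ∙ (c ∙ d))  ≡⟨ cong (a ∙_) (sym (assoc b c d)) ⟩
      a ∙ ((b ∙ c) ∙ d)  ≡⟨ cong (λ t → a ∙ (t ∙ d)) (comm b c) ⟩
      a ∙ ((c ∙ b) ∙ d)  ≡⟨ cong (a ∙_) (assoc c b d) ⟩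
      a ∙ (c ∙ (b ∙ d))  ≡⟨ sym (assoc a c (b ∙ d)) ⟩
      (a ∙ c) ∙ (b ∙ d)  ∎

  big-cong-∈ : (xs : List A) {f g : A → C} → (∀ {x} → x ∈ xs → f x ≡ g x) → big xs f ≡ big xs g
  big-cong-∈ [] e = refl
  big-cong-∈ (x ∷ xs) e = cong₂ _∙_ (e (here refl)) (big-cong-∈ xs (e ∘ there))

  big-cong : (xs : List A) {f g : A → C} → (∀ x → f x ≡ g x) → big xs f ≡ big xs g
  big-cong xs e = big-cong-∈ xs (λ {x} _ → e x)

  big-ε : (xs : List A) → big xs (λ _ → ε) ≡ ε
  big-ε [] = refl
  big-ε (x ∷ xs) = ≡.trans (identityˡ _) (big-ε xs)

  big-∙ : (xs : List A) (f g : A → C) → big xs (λ x → f x ∙ g x) ≡ big xs f ∙ big xs g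
  big-∙ [] f g = sym (identityˡ ε)
  big-∙ (x ∷ xs) f g = ≡.trans (cong ((f x ∙ g x) ∙_) (big-∙ xs f g)) (∙-interchange _ _ _ _)

  big-++ : (xs ys : List A) (f : A → C) → big (xs ++ ys) f ≡ big xs f ∙ big ys f
  big-++ [] ys f = sym (identityˡ _)
  big-++ (x ∷ xs) ys f = ≡.trans (cong (f x ∙_) (big-++ xs ys f)) (sym (assoc _ _ _))

  big-map : (h : A → B) (xs : List A) (f : B → C) → big (map h xs) f ≡ big xs (f ∘ h)
  big-map h [] f = refl
  big-map h (x ∷ xs) f = cong (f (h x) ∙_) (big-map h xs f)

  big-concatMap : (h : A → List B) (xs : List A) (f : B → C) →
    big (concatMap h xs) f ≡ big xs (λ x → big (h x) f)
  big-concatMap h [] f = refl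
  big-concatMap h (x ∷ xs) f =
    ≡.trans (big-++ (h x) (concatMap h xs) f) (cong (big (h x) f ∙_) (big-concatMap h xs f))

  big-swap : (xs : List A) (ys : List B) (f : A → B → C) →
    big xs (λ x → big ys (f x)) ≡ big ys (λ y → big xs (λ x → f x y))
  big-swap [] ys f = sym (big-ε ys)
  big-swap (x ∷ xs) ys f =
    ≡.trans (cong (big ys (f x) ∙_) (big-swap xs ys f)) (sym (big-∙ ys (f x) _))

  big-filterᵇ : (p : A → Bool) (xs : List A) (f : A → C) →
    big (List.filterᵇ p xs) f ≡ big xs (λ x → if p x then f x else ε)
  big-filterᵇ p [] f = refl
  big-filterᵇ p (x ∷ xs) f with p x
  ... | true = cong (f x ∙_) (big-filterᵇ p xs f)
  ... | false = ≡.trans (big-filterᵇ p xs f) (sym (identityˡ _))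

  big-if : (xs : List A) (b : Bool) (f : A → C) →
    big xs (λ x → if b then f x else ε) ≡ (if b then big xs f else ε)
  big-if xs true f = refl
  big-if xs false f = big-ε xs

  big-↭ : {xs ys : List A} (f : A → C) → xs ↭ ys → big xs f ≡ big ys f
  big-↭ f refl = refl
  big-↭ f (prep x p) = cong (f x ∙_) (big-↭ f p)
  big-↭ f (swap x y p) = ≡.trans (sym (assoc _ _ _))
    (≡.trans (cong₂ _∙_ (comm (f x) (f y)) (big-↭ f p)) (assoc _ _ _))
  big-↭ f (trans p q) = ≡.trans (big-↭ f p) (big-↭ f q)

  big-hom : {D : Set} {_⊕_ : D → D → D} {e : D} (φ : C → D) →
    φ ε ≡ e → (∀ a b → φ (a ∙ b) ≡ φ a ⊕ φ b) →
    (xs : List A) (f : A → C) → φ (big xs f) ≡ foldr _⊕_ e (map (φ ∘ f) xs)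
  big-hom φ φε φ∙ [] f = φε
  big-hom {_⊕_ = _⊕_} φ φε φ∙ (x ∷ xs) f =
    ≡.trans (φ∙ _ _) (cong (φ (f x) ⊕_) (big-hom φ φε φ∙ xs f))

  big-none : (_≟_ : DecidableEquality A) (a : A) (xs : List A) (g : A → C) →
    countB (λ b → ⌊ a ≟ b ⌋) xs ≡ 0 → big xs (λ b → if ⌊ a ≟ b ⌋ then g b else ε) ≡ ε
  big-none _≟_ a [] g e = refl
  big-none _≟_ a (b ∷ xs) g e with a ≟ b
  ... | no _ = ≡.trans (identityˡ _) (big-none _≟_ a xs g e)

  big-single : (_≟_ : DecidableEquality A) (a : A) (xs : List A) (g : A → C) →
    countB (λ b → ⌊ a ≟ b ⌋) xs ≡ 1 → big xs (λ b → if ⌊ a ≟ b ⌋ then g b else ε) ≡ g a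
  big-single _≟_ a (b ∷ xs) g e with a ≟ b
  ... | yes refl = ≡.trans (cong (g a ∙_) (big-none _≟_ a xs g (cong ℕ.pred e))) (identityʳ _)
  ... | no _ = ≡.trans (identityˡ _) (big-single _≟_ a xs g e)

  big-fibres : (_≟_ : DecidableEquality B) (cs : List B) →
    (∀ c → countB (λ b → ⌊ c ≟ b ⌋) cs ≡ 1) → (h : A → B) (z : List A) (f : A → C) →
    big z f ≡ big cs (λ c → big z (λ a → if ⌊ h a ≟ c ⌋ then f a else ε))
  big-fibres _≟_ cs once h z f = ≡.trans
    (big-cong z (λ a → sym (big-single _≟_ (h a) cs (λ _ → f a) (once (h a)))))
    (big-swap z cs _)

  -- Both lists enumerate the type without repetition, and a commutative operation does not see the
  -- order. Sorting `z` by its values leaves one term for each entry of `cs`.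
  big-once : (_≟_ : DecidableEquality A) (cs z : List A) →
    (∀ c → countB (λ b → ⌊ c ≟ b ⌋) cs ≡ 1) → (∀ c → countB (λ b → ⌊ c ≟ b ⌋) z ≡ 1) →
    (f : A → C) → big z f ≡ big cs f
  big-once _≟_ cs z once-cs once-z f = ≡.trans (big-fibres _≟_ cs once-cs (λ a → a) z f)
    (big-cong cs λ c → ≡.trans
      (big-cong z (λ a → cong (if_then f a else ε) (⌊⌋-sym _≟_ a c)))
      (big-single _≟_ c z f (once-z c)))

  big-allFin-suc : (n : ℕ) (f : Fin (suc n) → C) → big (allFin (suc n)) f ≡ f zero ∙ big (allFin n) (f ∘ suc)
  big-allFin-suc n f = cong (f zero ∙_)
    (≡.trans (cong (λ l → big l f) (sym (Listₚ.map-tabulate (λ i → i) suc))) (big-map suc (allFin n) f))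

  big-allVecs-suc : (xs : List A) (n : ℕ) (f : Vec A (suc n) → C) →
    big (allVecs xs (suc n)) f ≡ big xs (λ a → big (allVecs xs n) (λ v → f (a ∷ v)))
  big-allVecs-suc xs n f = ≡.trans (big-concatMap _ xs f)
    (big-cong xs (λ a → big-map (a ∷_) (allVecs xs n) f))

  big-allLists-suc : (xs : List A) (n : ℕ) (f : List A → C) →
    big (allLists xs (suc n)) f ≡ big xs (λ a → big (allLists xs n) (λ v → f (a ∷ v)))
  big-allLists-suc xs n f = ≡.trans (big-concatMap _ xs f)
    (big-cong xs (λ a → big-map (a ∷_) (allLists xs n) f))

  big-allLists : (xs : List A) (n : ℕ) (f : List A → C) →
    big (allLists xs n) f ≡ big (allVecs xs n) (f ∘ Vec.toList)
  big-allLists xs zero f = refl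
  big-allLists xs (suc n) f = ≡.trans (big-allLists-suc xs n f)
    (≡.trans (big-cong xs (λ a → big-allLists xs n (f ∘ (a ∷_)))) (sym (big-allVecs-suc xs n _)))

  -- Induction step for `big-columns`: choosing `a` columns is choosing the row of their top entries
  -- and then the shortened columns.
  big-zipCons : (xs : List A) (a b : ℕ) (h : Vec (Vec A (suc b)) a → C) →
    big (allVecs (allVecs xs (suc b)) a) h ≡
    big (allVecs xs a) (λ w → big (allVecs (allVecs xs b) a) (λ Y → h (Vec.zipWith _∷_ w Y)))
  big-zipCons xs zero b h = sym (identityʳ _)
  big-zipCons xs (suc a) b h = begin
    big (allVecs (allVecs xs (suc b)) (suc a)) h
      ≡⟨ big-allVecs-suc (allVecs xs (suc b)) a h ⟩
    big (allVecs xs (suc b)) (λ v → big (allVecs (allVecs xs (suc b)) a) (λ Y → h (v ∷ Y)))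
      ≡⟨ big-allVecs-suc xs b _ ⟩
    big xs (λ c → big (allVecs xs b) (λ v → big (allVecs (allVecs xs (suc b)) a) (λ Y → h ((c ∷ v) ∷ Y))))
      ≡⟨ big-cong xs (λ c → big-cong (allVecs xs b) (λ v → big-zipCons xs a b _)) ⟩
    big xs (λ c → big (allVecs xs b) (λ v → big (allVecs xs a) (λ w →
      big (allVecs (allVecs xs b) a) (λ Y → h ((c ∷ v) ∷ Vec.zipWith _∷_ w Y)))))
      ≡⟨ big-cong xs (λ c → big-swap (allVecs xs b) (allVecs xs a) _) ⟩
    big xs (λ c → big (allVecs xs a) (λ w → big (allVecs xs b) (λ v →
      big (allVecs (allVecs xs b) a) (λ Y → h ((c ∷ v) ∷ Vec.zipWith _∷_ w Y)))))
      ≡⟨ big-cong xs (λ c → big-cong (allVecs xs a) (λ w → sym (big-allVecs-suc (allVecs xs b) a _))) ⟩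
    big xs (λ c → big (allVecs xs a) (λ w →
      big (allVecs (allVecs xs b) (suc a)) (λ Y → h (Vec.zipWith _∷_ (c ∷ w) Y))))
      ≡⟨ sym (big-allVecs-suc xs a _) ⟩
    big (allVecs xs (suc a)) (λ w → big (allVecs (allVecs xs b) (suc a)) (λ Y → h (Vec.zipWith _∷_ w Y))) ∎

  private
    big-emptyColumns : (a : ℕ) (h : Vec (Vec A 0) a → C) →
      big (allVecs ([] ∷ []) a) h ≡ h (Vec.replicate a [])
    big-emptyColumns zero h = identityʳ _
    big-emptyColumns (suc a) h = ≡.trans (big-allVecs-suc ([] ∷ []) a h)
      (≡.trans (identityʳ _) (big-emptyColumns a (λ Y → h ([] ∷ Y))))

  -- Transposition is a bijection between the matrices given by rows and those given by columns. The
  -- two enumerations differ in order only.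
  big-columns : (xs : List A) (a b : ℕ) (h : Vec (Vec A b) a → C) →
    big (allVecs (allVecs xs a) b) (h ∘ columns) ≡ big (allVecs (allVecs xs b) a) h
  big-columns xs a zero h = ≡.trans (identityʳ _) (sym (big-emptyColumns a h))
  big-columns xs a (suc b) h = begin
    big (allVecs (allVecs xs a) (suc b)) (h ∘ columns)
      ≡⟨ big-allVecs-suc (allVecs xs a) b _ ⟩
    big (allVecs xs a) (λ w → big (allVecs (allVecs xs a) b) (λ W → h (Vec.zipWith _∷_ w (columns W))))
      ≡⟨ big-cong (allVecs xs a) (λ w → big-columns xs a b _) ⟩
    big (allVecs xs a) (λ w → big (allVecs (allVecs xs b) a) (λ Y → h (Vec.zipWith _∷_ w Y)))
      ≡⟨ sym (big-zipCons xs a b h) ⟩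
    big (allVecs (allVecs xs (suc b)) a) h ∎

  -- Lets the sum over tuples of permutations in `hyperdet` run over tuples of arbitrary words,
  -- where it can be transposed.
  big-allVecs-filterᵇ : (p : A → Bool) (xs : List A) (n : ℕ) (f : Vec A n → C) →
    big (allVecs (List.filterᵇ p xs) n) f ≡ big (allVecs xs n) (λ v → if allB p (Vec.toList v) then f v else ε)
  big-allVecs-filterᵇ p xs zero f = refl
  big-allVecs-filterᵇ p xs (suc n) f = begin
    big (allVecs (List.filterᵇ p xs) (suc n)) f
      ≡⟨ big-allVecs-suc (List.filterᵇ p xs) n f ⟩
    big (List.filterᵇ p xs) (λ a → big (allVecs (List.filterᵇ p xs) n) (λ v → f (a ∷ v)))
      ≡⟨ big-filterᵇ p xs _ ⟩
    big xs (λ a → if p a then big (allVecs (List.filterᵇ p xs) n) (λ v → f (a ∷ v)) else ε)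
      ≡⟨ big-cong xs head ⟩
    big xs (λ a → big (allVecs xs n) (λ v → if p a ∧ allB p (Vec.toList v) then f (a ∷ v) else ε))
      ≡⟨ sym (big-allVecs-suc xs n _) ⟩
    big (allVecs xs (suc n)) (λ v → if allB p (Vec.toList v) then f v else ε) ∎
    where
    head : ∀ a → (if p a then big (allVecs (List.filterᵇ p xs) n) (λ v → f (a ∷ v)) else ε) ≡
      big (allVecs xs n) (λ v → if p a ∧ allB p (Vec.toList v) then f (a ∷ v) else ε)
    head a with p a
    ... | true = big-allVecs-filterᵇ p xs n (λ v → f (a ∷ v))
    ... | false = sym (big-ε (allVecs xs n))

⌊⌋-⇔ : {P Q : Set} (p? : Dec P) (q? : Dec Q) → (P → Q) → (Q → P) → ⌊ p? ⌋ ≡ ⌊ q? ⌋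
⌊⌋-⇔ (yes _) (yes _) f g = refl
⌊⌋-⇔ (no _) (no _) f g = refl
⌊⌋-⇔ (yes p) (no ¬q) f g = contradiction (f p) ¬q
⌊⌋-⇔ (no ¬p) (yes q) f g = contradiction (g q) ¬p

module Σℕ = BigOp ℕₚ.+-0-isCommutativeMonoid
module Πℕ = BigOp ℕₚ.*-1-isCommutativeMonoid
module Σℤ = BigOp ℤₚ.+-0-isCommutativeMonoid
module Πℤ = BigOp ℤₚ.*-1-isCommutativeMonoid
module Σℚ = BigOp ℚₚ.+-0-isCommutativeMonoid
module Πℚ = BigOp ℚₚ.*-1-isCommutativeMonoid
module ⋀ = BigOp Boolₚ.∧-isCommutativeMonoid

bit : Bool → ℕ
bit b = if b then 1 else 0

length-big : (xs : List A) → length xs ≡ Σℕ.big xs (λ _ → 1)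
length-big [] = refl
length-big (x ∷ xs) = cong suc (length-big xs)

count-big : (p : A → Bool) (xs : List A) → countB p xs ≡ Σℕ.big xs (bit ∘ p)
count-big p xs = ≡.trans (length-big (List.filterᵇ p xs)) (Σℕ.big-filterᵇ p xs _)

count-self : (_≟_ : DecidableEquality A) (v : A) (xs : List A) →
  countB (λ u → ⌊ v ≟ u ⌋) (v ∷ xs) ≡ suc (countB (λ u → ⌊ v ≟ u ⌋) xs)
count-self _≟_ v xs rewrite ⌊⌋-refl _≟_ v = refl

count-cong : {p q : A → Bool} (xs : List A) → (∀ x → p x ≡ q x) → countB p xs ≡ countB q xs
count-cong {p = p} {q} xs e =
  ≡.trans (count-big p xs) (≡.trans (Σℕ.big-cong xs (cong bit ∘ e)) (sym (count-big q xs)))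

count-map : (p : B → Bool) (h : A → B) (xs : List A) → countB p (map h xs) ≡ countB (p ∘ h) xs
count-map p h xs =
  ≡.trans (count-big p (map h xs)) (≡.trans (Σℕ.big-map h xs _) (sym (count-big _ xs)))

count-filterᵇ : (p q : A → Bool) (xs : List A) →
  countB p (List.filterᵇ q xs) ≡ countB (λ x → q x ∧ p x) xs
count-filterᵇ p q [] = refl
count-filterᵇ p q (x ∷ xs) with q x
... | false = count-filterᵇ p q xs
... | true with p x
...   | true = cong suc (count-filterᵇ p q xs)
...   | false = count-filterᵇ p q xs

allB-big : (p : A → Bool) (xs : List A) → allB p xs ≡ ⋀.big xs p
allB-big p [] = refl
allB-big p (x ∷ xs) = cong (p x ∧_) (allB-big p xs)

allB-true⁻ : (p : A → Bool) (xs : List A) → allB p xs ≡ true → ∀ {x} → x ∈ xs → p x ≡ true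
allB-true⁻ p (x ∷ xs) e x∈ with p x in px
allB-true⁻ p (x ∷ xs) e (here refl) | true = px
allB-true⁻ p (x ∷ xs) e (there x∈) | true = allB-true⁻ p xs e x∈

allB-true⁺ : (p : A → Bool) (xs : List A) → (∀ {x} → x ∈ xs → p x ≡ true) → allB p xs ≡ true
allB-true⁺ p [] e = refl
allB-true⁺ p (x ∷ xs) e rewrite e (here refl) = allB-true⁺ p xs (e ∘ there)

≡ᵇ-true⁻ : ∀ {m n} → (m ≡ᵇ n) ≡ true → m ≡ n
≡ᵇ-true⁻ {m} {n} e = ℕₚ.≡ᵇ⇒≡ m n (Equivalence.from Boolₚ.T-≡ e)

≡ᵇ-true⁺ : ∀ {m n} → m ≡ n → (m ≡ᵇ n) ≡ true
≡ᵇ-true⁺ {zero} refl = refl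
≡ᵇ-true⁺ {suc m} refl = ≡ᵇ-true⁺ {m} refl

-- Lists that enumerate a type without repetition

module _ (_≟A_ : DecidableEquality A) (_≟B_ : DecidableEquality B) (_≟E_ : DecidableEquality E) where

  -- Injectivity of `con` confines the occurrences of `con a b` to the block of `a`, and inside it
  -- to the place of `b`.
  once-product : (con : A → B → E) → (∀ {a b a′ b′} → con a b ≡ con a′ b′ → a ≡ a′ × b ≡ b′) →
    ∀ {a b xs ys} → countB (λ x → ⌊ a ≟A x ⌋) xs ≡ 1 → countB (λ y → ⌊ b ≟B y ⌋) ys ≡ 1 →
    countB (λ e → ⌊ con a b ≟E e ⌋) (concatMap (λ x → map (con x) ys) xs) ≡ 1
  once-product con inj {a} {b} {xs} {ys} a-once b-once = begin
    countB (λ e → ⌊ con a b ≟E e ⌋) (concatMap (λ x → map (con x) ys) xs)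
      ≡⟨ count-big _ (concatMap (λ x → map (con x) ys) xs) ⟩
    Σℕ.big (concatMap (λ x → map (con x) ys) xs) (λ e → bit ⌊ con a b ≟E e ⌋)
      ≡⟨ Σℕ.big-concatMap _ xs _ ⟩
    Σℕ.big xs (λ x → Σℕ.big (map (con x) ys) (λ e → bit ⌊ con a b ≟E e ⌋))
      ≡⟨ Σℕ.big-cong xs (λ x → ≡.trans (Σℕ.big-map (con x) ys _) (inner x)) ⟩
    Σℕ.big xs (λ x → if ⌊ a ≟A x ⌋ then 1 else 0)
      ≡⟨ Σℕ.big-single _≟A_ a xs (λ _ → 1) a-once ⟩
    1 ∎
    where
    inner : ∀ x → Σℕ.big ys (λ y → bit ⌊ con a b ≟E con x y ⌋) ≡ (if ⌊ a ≟A x ⌋ then 1 else 0)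
    inner x with a ≟A x
    ... | yes refl = ≡.trans
          (Σℕ.big-cong ys (λ y → cong bit (⌊⌋-⇔ (con a b ≟E con a y) (b ≟B y) (proj₂ ∘ inj) (cong (con a)))))
          (≡.trans (sym (count-big _ ys)) b-once)
    ... | no a≢x = ≡.trans (Σℕ.big-cong ys (λ y → cong bit (neither y))) (Σℕ.big-ε ys)
      where
      neither : ∀ y → ⌊ con a b ≟E con x y ⌋ ≡ false
      neither y with con a b ≟E con x y
      ... | yes e = contradiction (proj₁ (inj e)) a≢x
      ... | no _ = refl

once-allFin : ∀ n (c : Fin n) → countB (λ b → ⌊ c ≟F b ⌋) (allFin n) ≡ 1
once-allFin (suc n) c = ≡.trans (count-big _ (allFin (suc n)))
  (≡.trans (Σℕ.big-allFin-suc n (λ b → bit ⌊ c ≟F b ⌋)) (rest c))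
  where
  rest : ∀ c → bit ⌊ c ≟F zero ⌋ ℕ.+ Σℕ.big (allFin n) (λ b → bit ⌊ c ≟F suc b ⌋) ≡ 1
  rest zero = cong suc (Σℕ.big-ε (allFin n))
  rest (suc c) = ≡.trans
    (Σℕ.big-cong (allFin n) (λ b → cong bit (⌊⌋-⇔ (suc c ≟F suc b) (c ≟F b) suc-injective (cong suc))))
    (≡.trans (sym (count-big _ (allFin n))) (once-allFin n c))

module _ (_≟_ : DecidableEquality A) (xs : List A) (once : ∀ a → countB (λ x → ⌊ a ≟ x ⌋) xs ≡ 1) where

  once-allVecs : ∀ {n} (v : Vec A n) → countB (λ w → ⌊ Vecₚ.≡-dec _≟_ v w ⌋) (allVecs xs n) ≡ 1
  once-allVecs [] = refl
  once-allVecs {suc n} (a ∷ v) =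
    once-product _≟_ (Vecₚ.≡-dec _≟_) (Vecₚ.≡-dec _≟_) _∷_ Vecₚ.∷-injective
      {xs = xs} {ys = allVecs xs n} (once a) (once-allVecs v)

  once-allLists : ∀ (v : List A) → countB (λ w → ⌊ Listₚ.≡-dec _≟_ v w ⌋) (allLists xs (length v)) ≡ 1
  once-allLists [] = refl
  once-allLists (a ∷ v) =
    once-product _≟_ (Listₚ.≡-dec _≟_) (Listₚ.≡-dec _≟_) _∷_ Listₚ.∷-injective
      {xs = xs} {ys = allLists xs (length v)} (once a) (once-allLists v)

-- Integers, naturals and reciprocals inside the rationals

private
  toℚᵘ-ℤtoℚ : ∀ z → ℚ.toℚᵘ (ℤtoℚ z) ℚᵘ.≃ mkℚᵘ z 0
  toℚᵘ-ℤtoℚ z = ℚₚ.toℚᵘ-fromℚᵘ (mkℚᵘ z 0)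

ℤtoℚ-* : ∀ a b → ℤtoℚ (a ℤ.* b) ≡ ℤtoℚ a ℚ.* ℤtoℚ b
ℤtoℚ-* a b = ℚₚ.toℚᵘ-injective (ℚᵘₚ.≃-trans (toℚᵘ-ℤtoℚ (a ℤ.* b)) (ℚᵘₚ.≃-sym
  (ℚᵘₚ.≃-trans (ℚₚ.toℚᵘ-homo-* (ℤtoℚ a) (ℤtoℚ b))
    (ℚᵘₚ.*-cong (toℚᵘ-ℤtoℚ a) (toℚᵘ-ℤtoℚ b)))))

ℤtoℚ-+ : ∀ a b → ℤtoℚ (a ℤ.+ b) ≡ ℤtoℚ a ℚ.+ ℤtoℚ b
ℤtoℚ-+ a b = ℚₚ.toℚᵘ-injective (ℚᵘₚ.≃-trans (toℚᵘ-ℤtoℚ (a ℤ.+ b)) (ℚᵘₚ.≃-sym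
  (ℚᵘₚ.≃-trans (ℚₚ.toℚᵘ-homo-+ (ℤtoℚ a) (ℤtoℚ b))
  (ℚᵘₚ.≃-trans (ℚᵘₚ.+-cong (toℚᵘ-ℤtoℚ a) (toℚᵘ-ℤtoℚ b))
    (*≡* (cong (ℤ._* + 1) (cong₂ ℤ._+_ (ℤₚ.*-identityʳ a) (ℤₚ.*-identityʳ b))))))))

ι : ℕ → ℚ
ι m = ℤtoℚ (+ m)

ι-* : ∀ a b → ι (a ℕ.* b) ≡ ι a ℚ.* ι b
ι-* a b = ≡.trans (cong ℤtoℚ (ℤₚ.pos-* a b)) (ℤtoℚ-* (+ a) (+ b))

ι-suc : ∀ m → ι (suc m) ≡ 1ℚ ℚ.+ ι m
ι-suc m = ℤtoℚ-+ (+ 1) (+ m)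

recipℕ-inverseʳ : ∀ m → .{{ℕ.NonZero m}} → ι m ℚ.* recipℕ m ≡ 1ℚ
recipℕ-inverseʳ (suc m) = ℚₚ.toℚᵘ-injective
  (ℚᵘₚ.≃-trans (ℚₚ.toℚᵘ-homo-* (ι (suc m)) (recipℕ (suc m)))
  (ℚᵘₚ.≃-trans (ℚᵘₚ.*-cong (toℚᵘ-ℤtoℚ (+ suc m)) (ℚₚ.toℚᵘ-fromℚᵘ (mkℚᵘ (+ 1) m)))
    (*≡* (cong +_ (lemma m)))))
  where
  lemma : ∀ m → suc m ℕ.* 1 ℕ.* 1 ≡ 1 ℕ.* (1 ℕ.* suc m)
  lemma m = ≡.trans (ℕₚ.*-identityʳ _) (≡.trans (ℕₚ.*-comm (suc m) 1) (sym (ℕₚ.*-identityˡ _)))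

*-big : (q : ℚ) (xs : List A) (f : A → ℚ) → q ℚ.* Σℚ.big xs f ≡ Σℚ.big xs (λ x → q ℚ.* f x)
*-big q xs f = Σℚ.big-hom (q ℚ.*_) (ℚₚ.*-zeroʳ q) (ℚₚ.*-distribˡ-+ q) xs f

big-* : (xs : List A) (f : A → ℚ) (q : ℚ) → Σℚ.big xs f ℚ.* q ≡ Σℚ.big xs (λ x → f x ℚ.* q)
big-* xs f q = Σℚ.big-hom (ℚ._* q) (ℚₚ.*-zeroˡ q) (ℚₚ.*-distribʳ-+ q) xs f

if-*ˡ : ∀ (q : ℚ) b x → q ℚ.* (if b then x else 0ℚ) ≡ (if b then q ℚ.* x else 0ℚ)
if-*ˡ q true x = refl
if-*ˡ q false x = ℚₚ.*-zeroʳ q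

if-*ʳ : ∀ b x (q : ℚ) → (if b then x else 0ℚ) ℚ.* q ≡ (if b then x ℚ.* q else 0ℚ)
if-*ʳ true x q = refl
if-*ʳ false x q = ℚₚ.*-zeroˡ q

-- Matchings of monomials and the Leibniz rule

-- One entry for each position, so an equal variable is picked as often as it occurs. This gives the
-- factor r in the derivative of an r-th power.
picks : List A → List (A × List A)
picks [] = []
picks (y ∷ Y) = (y , Y) ∷ map (map₂ (y ∷_)) (picks Y)

picks-↭ : (T : List A) → ∀ {u T′} → (u , T′) ∈ picks T → T ↭ u ∷ T′
picks-↭ (y ∷ Y) (here refl) = refl
picks-↭ (y ∷ Y) (there i) with ∈-map⁻ (map₂ (y ∷_)) i
... | (u , T′) , j , refl = trans (prep y (picks-↭ Y j)) (swap y u refl)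

map-proj₁-picks : (T : List A) → map proj₁ (picks T) ≡ T
map-proj₁-picks [] = refl
map-proj₁-picks (y ∷ Y) =
  cong (y ∷_) (≡.trans (sym (Listₚ.map-∘ (picks Y))) (map-proj₁-picks Y))

big-picks-++ : (T₁ T₂ : List A) (φ : A × List A → ℚ) →
  Σℚ.big (picks (T₁ ++ T₂)) φ ≡
  Σℚ.big (picks T₁) (φ ∘ map₂ (_++ T₂)) ℚ.+ Σℚ.big (picks T₂) (φ ∘ map₂ (T₁ ++_))
big-picks-++ [] T₂ φ = sym (ℚₚ.+-identityˡ _)
big-picks-++ (y ∷ T₁) T₂ φ = ≡.trans (cong (φ (y , T₁ ++ T₂) ℚ.+_) (begin
    Σℚ.big (map (map₂ (y ∷_)) (picks (T₁ ++ T₂))) φ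
      ≡⟨ Σℚ.big-map (map₂ (y ∷_)) (picks (T₁ ++ T₂)) φ ⟩
    Σℚ.big (picks (T₁ ++ T₂)) (φ ∘ map₂ (y ∷_))
      ≡⟨ big-picks-++ T₁ T₂ (φ ∘ map₂ (y ∷_)) ⟩
    Σℚ.big (picks T₁) (φ ∘ map₂ (y ∷_) ∘ map₂ (_++ T₂)) ℚ.+ Σℚ.big (picks T₂) (φ ∘ map₂ ((y ∷ T₁) ++_))
      ≡⟨ cong (ℚ._+ Σℚ.big (picks T₂) (φ ∘ map₂ ((y ∷ T₁) ++_))) (sym (Σℚ.big-map (map₂ (y ∷_)) (picks T₁) _)) ⟩
    Σℚ.big (map (map₂ (y ∷_)) (picks T₁)) (φ ∘ map₂ (_++ T₂)) ℚ.+ Σℚ.big (picks T₂) (φ ∘ map₂ ((y ∷ T₁) ++_)) ∎))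
  (sym (ℚₚ.+-assoc (φ (y , T₁ ++ T₂)) (Σℚ.big (map (map₂ (y ∷_)) (picks T₁)) (φ ∘ map₂ (_++ T₂))) _))

-- A letter `u` can be inserted into a word of length `m` at `suc m` places, and each insertion is
-- undone by exactly one pick.
big-picks : (xs : List A) (m : ℕ) (φ : A × List A → ℚ) →
  Σℚ.big (allLists xs (suc m)) (λ Y → Σℚ.big (picks Y) φ) ≡
  ι (suc m) ℚ.* Σℚ.big xs (λ u → Σℚ.big (allLists xs m) (λ Y → φ (u , Y)))
big-picks xs m φ = ≡.trans (Σℚ.big-allLists-suc xs m _) (≡.trans
    (≡.trans (Σℚ.big-cong xs (λ y → Σℚ.big-∙ (allLists xs m) _ _)) (Σℚ.big-∙ xs _ _))
    (≡.trans (cong (total ℚ.+_) (rest m φ)) (sym (≡.trans (cong (ℚ._* total) (ι-suc m))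
      (≡.trans (ℚₚ.*-distribʳ-+ total 1ℚ (ι m)) (cong (ℚ._+ ι m ℚ.* total) (ℚₚ.*-identityˡ total)))))))
  where
  total = Σℚ.big xs (λ u → Σℚ.big (allLists xs m) (λ Y → φ (u , Y)))
  rest : ∀ m φ → Σℚ.big xs (λ y → Σℚ.big (allLists xs m) (λ Y → Σℚ.big (map (map₂ (y ∷_)) (picks Y)) φ)) ≡
    ι m ℚ.* Σℚ.big xs (λ u → Σℚ.big (allLists xs m) (λ Y → φ (u , Y)))
  rest zero φ = ≡.trans (Σℚ.big-ε xs) (sym (ℚₚ.*-zeroˡ (Σℚ.big xs (λ u → Σℚ.big (allLists xs zero) (λ Y → φ (u , Y))))))
  rest (suc m) φ = begin
    Σℚ.big xs (λ y → Σℚ.big (allLists xs (suc m)) (λ Y → Σℚ.big (map (map₂ (y ∷_)) (picks Y)) φ))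
      ≡⟨ Σℚ.big-cong xs (λ y → Σℚ.big-cong (allLists xs (suc m)) (λ Y → Σℚ.big-map (map₂ (y ∷_)) (picks Y) φ)) ⟩
    Σℚ.big xs (λ y → Σℚ.big (allLists xs (suc m)) (λ Y → Σℚ.big (picks Y) (φ ∘ map₂ (y ∷_))))
      ≡⟨ Σℚ.big-cong xs (λ y → big-picks xs m (φ ∘ map₂ (y ∷_))) ⟩
    Σℚ.big xs (λ y → ι (suc m) ℚ.* Σℚ.big xs (λ u → Σℚ.big (allLists xs m) (λ Y → φ (u , y ∷ Y))))
      ≡⟨ sym (*-big (ι (suc m)) xs _) ⟩
    ι (suc m) ℚ.* Σℚ.big xs (λ y → Σℚ.big xs (λ u → Σℚ.big (allLists xs m) (λ Y → φ (u , y ∷ Y))))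
      -- The head `y` and the picked letter `u` range over the same list; after the exchange `y`
      -- rejoins the rest of the word.
      ≡⟨ cong (ι (suc m) ℚ.*_) (≡.trans (Σℚ.big-swap xs xs _)
           (Σℚ.big-cong xs (λ u → sym (Σℚ.big-allLists-suc xs m _)))) ⟩
    ι (suc m) ℚ.* Σℚ.big xs (λ u → Σℚ.big (allLists xs (suc m)) (λ Y → φ (u , Y))) ∎

-- Indexed by subsets of positions rather than by distinct submonomials, which removes the binomial
-- coefficients from the Leibniz rule.
splits : List A → List (List A × List A)
splits [] = ([] , []) ∷ []
splits (v ∷ M) = map (map₁ (v ∷_)) (splits M) ++ map (map₂ (v ∷_)) (splits M)

big-splits-∷ : (v : A) (M : List A) (φ : List A × List A → ℚ) →
  Σℚ.big (splits (v ∷ M)) φ ≡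
  Σℚ.big (splits M) (φ ∘ map₁ (v ∷_)) ℚ.+ Σℚ.big (splits M) (φ ∘ map₂ (v ∷_))
big-splits-∷ v M φ = ≡.trans (Σℚ.big-++ (map (map₁ (v ∷_)) (splits M)) _ φ)
  (cong₂ ℚ._+_ (Σℚ.big-map (map₁ (v ∷_)) (splits M) φ) (Σℚ.big-map (map₂ (v ∷_)) (splits M) φ))

AdjacentSymmetric : (List A → ℚ) → Set _
AdjacentSymmetric g = ∀ pre a b post → g (pre ++ a ∷ b ∷ post) ≡ g (pre ++ b ∷ a ∷ post)

-- Adjacent transpositions carry the picked entry to the front.
symmetric-picks : {g : List A → ℚ} → AdjacentSymmetric g → (Y : List A) →
  ∀ {u T′} → (u , T′) ∈ picks Y → g Y ≡ g (u ∷ T′)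
symmetric-picks s (y ∷ Y) (here refl) = refl
symmetric-picks {g = g} s (y ∷ Y) (there i) with ∈-map⁻ (map₂ (y ∷_)) i
... | (u , T′) , j , refl =
  ≡.trans (symmetric-picks {g = g ∘ (y ∷_)} (λ pre → s (y ∷ pre)) Y j) (s [] y u T′)

count-const : (p : A → Bool) (T : List A) (c : ℚ) →
  Σℚ.big T (λ u → if p u then c else 0ℚ) ≡ ι (countB p T) ℚ.* c
count-const p [] c = sym (ℚₚ.*-zeroˡ c)
count-const p (u ∷ T) c with p u
... | false = ≡.trans (ℚₚ.+-identityˡ _) (count-const p T c)
... | true = begin
  c ℚ.+ Σℚ.big T (λ u → if p u then c else 0ℚ)  ≡⟨ cong₂ ℚ._+_ (sym (ℚₚ.*-identityˡ c)) (count-const p T c) ⟩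
  1ℚ ℚ.* c ℚ.+ ι (countB p T) ℚ.* c             ≡⟨ sym (ℚₚ.*-distribʳ-+ c 1ℚ (ι (countB p T))) ⟩
  (1ℚ ℚ.+ ι (countB p T)) ℚ.* c                 ≡⟨ cong (ℚ._* c) (sym (ι-suc (countB p T))) ⟩
  ι (suc (countB p T)) ℚ.* c                    ∎

count-↭ : (p : A → Bool) {xs ys : List A} → xs ↭ ys → countB p xs ≡ countB p ys
count-↭ p {xs} {ys} xs↭ys =
  ≡.trans (count-big p xs) (≡.trans (Σℕ.big-↭ _ xs↭ys) (sym (count-big p ys)))

module Matching {A : Set} (_≟_ : DecidableEquality A) where

  -- The number of bijections from M to T respecting the entries: the value at 0 of the
  -- partial derivative of the monomial T with respect to the variables in M.
  match : List A → List A → ℚ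
  match [] [] = 1ℚ
  match [] (_ ∷ _) = 0ℚ
  match (v ∷ M) T = Σℚ.big (picks T) (λ p → if ⌊ v ≟ proj₁ p ⌋ then match M (proj₂ p) else 0ℚ)

  -- Leibniz rule
  match-++ : (M T₁ T₂ : List A) →
    match M (T₁ ++ T₂) ≡ Σℚ.big (splits M) (λ s → match (proj₁ s) T₁ ℚ.* match (proj₂ s) T₂)
  match-++ [] [] T₂ = sym (≡.trans (ℚₚ.+-identityʳ _) (ℚₚ.*-identityˡ _))
  match-++ [] (_ ∷ _) T₂ = sym (≡.trans (ℚₚ.+-identityʳ _) (ℚₚ.*-zeroˡ (match [] T₂)))
  match-++ (v ∷ M) T₁ T₂ = ≡.trans (big-picks-++ T₁ T₂ _)
    (≡.trans (cong₂ ℚ._+_ left right) (sym (big-splits-∷ v M _)))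
    where
    -- Here `v` is matched inside `T₁` and joins the first part of the split; `right` is the other
    -- case.
    left : Σℚ.big (picks T₁) (λ p → if ⌊ v ≟ proj₁ p ⌋ then match M (proj₂ p ++ T₂) else 0ℚ) ≡
      Σℚ.big (splits M) (λ s → match (v ∷ proj₁ s) T₁ ℚ.* match (proj₂ s) T₂)
    left = begin
      Σℚ.big (picks T₁) (λ p → if ⌊ v ≟ proj₁ p ⌋ then match M (proj₂ p ++ T₂) else 0ℚ)
        ≡⟨ Σℚ.big-cong (picks T₁) (λ p → ≡.trans
             (cong (if ⌊ v ≟ proj₁ p ⌋ then_else 0ℚ) (match-++ M (proj₂ p) T₂))
             (≡.trans (sym (Σℚ.big-if (splits M) ⌊ v ≟ proj₁ p ⌋ _))
               (Σℚ.big-cong (splits M) (λ s → sym (if-*ʳ ⌊ v ≟ proj₁ p ⌋ _ (match (proj₂ s) T₂)))))) ⟩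
      Σℚ.big (picks T₁) (λ p → Σℚ.big (splits M) (λ s →
        (if ⌊ v ≟ proj₁ p ⌋ then match (proj₁ s) (proj₂ p) else 0ℚ) ℚ.* match (proj₂ s) T₂))
        ≡⟨ Σℚ.big-swap (picks T₁) (splits M) _ ⟩
      Σℚ.big (splits M) (λ s → Σℚ.big (picks T₁) (λ p →
        (if ⌊ v ≟ proj₁ p ⌋ then match (proj₁ s) (proj₂ p) else 0ℚ) ℚ.* match (proj₂ s) T₂))
        ≡⟨ Σℚ.big-cong (splits M) (λ s → sym (big-* (picks T₁) _ (match (proj₂ s) T₂))) ⟩
      Σℚ.big (splits M) (λ s → match (v ∷ proj₁ s) T₁ ℚ.* match (proj₂ s) T₂) ∎
    right : Σℚ.big (picks T₂) (λ p → if ⌊ v ≟ proj₁ p ⌋ then match M (T₁ ++ proj₂ p) else 0ℚ) ≡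
      Σℚ.big (splits M) (λ s → match (proj₁ s) T₁ ℚ.* match (v ∷ proj₂ s) T₂)
    right = begin
      Σℚ.big (picks T₂) (λ p → if ⌊ v ≟ proj₁ p ⌋ then match M (T₁ ++ proj₂ p) else 0ℚ)
        ≡⟨ Σℚ.big-cong (picks T₂) (λ p → ≡.trans
             (cong (if ⌊ v ≟ proj₁ p ⌋ then_else 0ℚ) (match-++ M T₁ (proj₂ p)))
             (≡.trans (sym (Σℚ.big-if (splits M) ⌊ v ≟ proj₁ p ⌋ _))
               (Σℚ.big-cong (splits M) (λ s → sym (if-*ˡ (match (proj₁ s) T₁) ⌊ v ≟ proj₁ p ⌋ _))))) ⟩
      Σℚ.big (picks T₂) (λ p → Σℚ.big (splits M) (λ s →
        match (proj₁ s) T₁ ℚ.* (if ⌊ v ≟ proj₁ p ⌋ then match (proj₂ s) (proj₂ p) else 0ℚ)))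
        ≡⟨ Σℚ.big-swap (picks T₂) (splits M) _ ⟩
      Σℚ.big (splits M) (λ s → Σℚ.big (picks T₂) (λ p →
        match (proj₁ s) T₁ ℚ.* (if ⌊ v ≟ proj₁ p ⌋ then match (proj₂ s) (proj₂ p) else 0ℚ)))
        ≡⟨ Σℚ.big-cong (splits M) (λ s → sym (*-big (match (proj₁ s) T₁) (picks T₂) _)) ⟩
      Σℚ.big (splits M) (λ s → match (proj₁ s) T₁ ℚ.* match (v ∷ proj₂ s) T₂) ∎

  match-≁ : (M T : List A) → ¬ (T ↭ M) → match M T ≡ 0ℚ
  match-≁ [] [] ≁ = contradiction refl ≁
  match-≁ [] (_ ∷ _) ≁ = refl
  match-≁ (v ∷ M) T ≁ = ≡.trans (Σℚ.big-cong-∈ (picks T) term) (Σℚ.big-ε (picks T))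
    where
    term : ∀ {p} → p ∈ picks T → (if ⌊ v ≟ proj₁ p ⌋ then match M (proj₂ p) else 0ℚ) ≡ 0ℚ
    term {u , T′} i with v ≟ u
    ... | no _ = refl
    ... | yes refl = match-≁ M T′ (λ T′↭M → ≁ (trans (picks-↭ T i) (prep v T′↭M)))

  -- A recursive form of ‖M‖: each position contributes the number of equal entries from there on,
  -- and for a variable occurring r times these factors multiply to r!.
  multiplicity : List A → ℕ
  multiplicity [] = 1
  multiplicity (v ∷ M) = suc (countB (λ u → ⌊ v ≟ u ⌋) M) ℕ.* multiplicity M

  -- The head `v` has one possible partner for each equal entry of `T`; whichever is removed, a
  -- rearrangement of `M` remains.
  match-↭ : (M T : List A) → T ↭ M → match M T ≡ ι (multiplicity M)
  match-↭ [] T T↭[] with ↭-empty-inv T↭[]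
  ... | refl = refl
  match-↭ (v ∷ M) T T↭ = begin
    Σℚ.big (picks T) (λ p → if ⌊ v ≟ proj₁ p ⌋ then match M (proj₂ p) else 0ℚ)
      ≡⟨ Σℚ.big-cong-∈ (picks T) term ⟩
    Σℚ.big (picks T) (λ p → if ⌊ v ≟ proj₁ p ⌋ then ι (multiplicity M) else 0ℚ)
      ≡⟨ sym (Σℚ.big-map proj₁ (picks T) _) ⟩
    Σℚ.big (map proj₁ (picks T)) (λ u → if ⌊ v ≟ u ⌋ then ι (multiplicity M) else 0ℚ)
      ≡⟨ cong (λ T → Σℚ.big T (λ u → if ⌊ v ≟ u ⌋ then ι (multiplicity M) else 0ℚ)) (map-proj₁-picks T) ⟩
    Σℚ.big T (λ u → if ⌊ v ≟ u ⌋ then ι (multiplicity M) else 0ℚ)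
      ≡⟨ count-const _ T _ ⟩
    ι (countB (λ u → ⌊ v ≟ u ⌋) T) ℚ.* ι (multiplicity M)
      ≡⟨ cong (λ n → ι n ℚ.* ι (multiplicity M)) (≡.trans (count-↭ _ T↭) (count-self _≟_ v M)) ⟩
    ι (suc (countB (λ u → ⌊ v ≟ u ⌋) M)) ℚ.* ι (multiplicity M)
      ≡⟨ sym (ι-* (suc (countB (λ u → ⌊ v ≟ u ⌋) M)) (multiplicity M)) ⟩
    ι (multiplicity (v ∷ M)) ∎
    where
    term : ∀ {p} → p ∈ picks T → (if ⌊ v ≟ proj₁ p ⌋ then match M (proj₂ p) else 0ℚ) ≡
      (if ⌊ v ≟ proj₁ p ⌋ then ι (multiplicity M) else 0ℚ)
    term {u , T′} i with v ≟ u
    ... | no _ = refl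
    ... | yes refl = match-↭ M T′ (drop-∷ (trans (↭-sym (picks-↭ T i)) T↭))

  -- A bijection from `M` to `Y` that respects the entries determines `Y`, so the pairs of a word
  -- and such a bijection number `length M !`. On each of them `g Y` equals `g M` by symmetry. For
  -- the hyperdeterminant this factorial cancels 1/k!.
  big-match : (xs : List A) → (∀ a → countB (λ x → ⌊ a ≟ x ⌋) xs ≡ 1) →
    {g : List A → ℚ} → AdjacentSymmetric g → (M : List A) →
    Σℚ.big (allLists xs (length M)) (λ Y → g Y ℚ.* match M Y) ≡ ι (length M !) ℚ.* g M
  big-match xs once {g} s [] = ≡.trans (ℚₚ.+-identityʳ _) (ℚₚ.*-comm (g []) 1ℚ)
  big-match xs once {g} s (v ∷ M) = begin
    Σℚ.big (allLists xs (suc (length M))) (λ Y → g Y ℚ.* match (v ∷ M) Y)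
      ≡⟨ Σℚ.big-cong (allLists xs (suc (length M))) (λ Y → ≡.trans (*-big (g Y) (picks Y) _)
           (Σℚ.big-cong-∈ (picks Y) (λ {p} i → ≡.trans
             (cong (ℚ._* (if ⌊ v ≟ proj₁ p ⌋ then match M (proj₂ p) else 0ℚ)) (symmetric-picks {g = g} s Y i))
             (if-*ˡ (g (proj₁ p ∷ proj₂ p)) ⌊ v ≟ proj₁ p ⌋ _)))) ⟩
    Σℚ.big (allLists xs (suc (length M))) (λ Y → Σℚ.big (picks Y) (λ p →
      if ⌊ v ≟ proj₁ p ⌋ then g (proj₁ p ∷ proj₂ p) ℚ.* match M (proj₂ p) else 0ℚ))
      ≡⟨ big-picks xs (length M) _ ⟩
    ι (suc (length M)) ℚ.* Σℚ.big xs (λ u → Σℚ.big (allLists xs (length M)) (λ Y →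
      if ⌊ v ≟ u ⌋ then g (u ∷ Y) ℚ.* match M Y else 0ℚ))
      ≡⟨ cong (ι (suc (length M)) ℚ.*_) (≡.trans
           (Σℚ.big-cong xs (λ u → Σℚ.big-if (allLists xs (length M)) ⌊ v ≟ u ⌋ _))
           (Σℚ.big-single _≟_ v xs _ (once v))) ⟩
    ι (suc (length M)) ℚ.* Σℚ.big (allLists xs (length M)) (λ Y → g (v ∷ Y) ℚ.* match M Y)
      ≡⟨ cong (ι (suc (length M)) ℚ.*_) (big-match xs once {g ∘ (v ∷_)} (λ pre → s (v ∷ pre)) M) ⟩
    ι (suc (length M)) ℚ.* (ι (length M !) ℚ.* g (v ∷ M))
      ≡⟨ sym (ℚₚ.*-assoc (ι (suc (length M))) (ι (length M !)) (g (v ∷ M))) ⟩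
    ι (suc (length M)) ℚ.* ι (length M !) ℚ.* g (v ∷ M)
      ≡⟨ cong (ℚ._* g (v ∷ M)) (sym (ι-* (suc (length M)) (length M !))) ⟩
    ι (suc (length M) !) ℚ.* g (v ∷ M) ∎

  -- The n-fold Leibniz expansion with `F` as the family of derivatives of one factor. The start
  -- `match M []` is the derivative at 0 of the constant 1.
  convolve : (List A → ℚ) → ℕ → List A → ℚ
  convolve F zero M = match M []
  convolve F (suc n) M = Σℚ.big (splits M) (λ s → F (proj₁ s) ℚ.* convolve F n (proj₂ s))

-- Distributing a monomial over labelled factors

fibre : {n : ℕ} → Fin n → List (A × Fin n) → List A
fibre p z = map proj₁ (List.filterᵇ (λ q → ⌊ proj₂ q ≟F p ⌋) z)

lowerLabels : {n : ℕ} → List (A × Fin (suc n)) → List (A × Fin n)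
lowerLabels [] = []
lowerLabels ((v , zero) ∷ z) = lowerLabels z
lowerLabels ((v , suc p) ∷ z) = (v , p) ∷ lowerLabels z

fibre-suc : {n : ℕ} (p : Fin n) (z : List (A × Fin (suc n))) → fibre (suc p) z ≡ fibre p (lowerLabels z)
fibre-suc p [] = refl
fibre-suc p ((v , zero) ∷ z) = fibre-suc p z
fibre-suc p ((v , suc q) ∷ z) with q ≟F p
... | yes _ = cong (v ∷_) (fibre-suc p z)
... | no _ = fibre-suc p z

-- A labelling by {0,…,n} is a subset (the label 0) together with a labelling of its complement.
big-labellings : (n : ℕ) (M : List A) (H : List A → List (A × Fin n) → ℚ) →
  Σℚ.big (allLists (allFin (suc n)) (length M)) (λ x → H (fibre zero (zip M x)) (lowerLabels (zip M x))) ≡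
  Σℚ.big (splits M) (λ s → Σℚ.big (allLists (allFin n) (length (proj₂ s))) (λ x → H (proj₁ s) (zip (proj₂ s) x)))
big-labellings n [] H = sym (ℚₚ.+-identityʳ _)
big-labellings n (v ∷ M) H = begin
  Σℚ.big (allLists (allFin (suc n)) (suc (length M)))
    (λ x → H (fibre zero (zip (v ∷ M) x)) (lowerLabels (zip (v ∷ M) x)))
    ≡⟨ Σℚ.big-allLists-suc (allFin (suc n)) (length M) _ ⟩
  Σℚ.big (allFin (suc n)) (λ p → Σℚ.big words
    (λ x → H (fibre zero ((v , p) ∷ zip M x)) (lowerLabels ((v , p) ∷ zip M x))))
    ≡⟨ Σℚ.big-allFin-suc n (λ p → Σℚ.big words
         (λ x → H (fibre zero ((v , p) ∷ zip M x)) (lowerLabels ((v , p) ∷ zip M x)))) ⟩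
  Σℚ.big words (λ x → H (v ∷ fibre zero (zip M x)) (lowerLabels (zip M x))) ℚ.+
  Σℚ.big (allFin n) (λ p → Σℚ.big words (λ x → H (fibre zero (zip M x)) ((v , p) ∷ lowerLabels (zip M x))))
    -- `H` is arbitrary precisely so that the head `v` can be absorbed into either argument before
    -- the recursive call.
    ≡⟨ cong₂ ℚ._+_ (big-labellings n M (λ A → H (v ∷ A)))
         (Σℚ.big-cong (allFin n) (λ p → big-labellings n M (λ A z → H A ((v , p) ∷ z)))) ⟩
  with-v ℚ.+
  Σℚ.big (allFin n) (λ p → Σℚ.big (splits M) (λ s →
    Σℚ.big (allLists (allFin n) (length (proj₂ s))) (λ x → H (proj₁ s) ((v , p) ∷ zip (proj₂ s) x))))
    ≡⟨ cong (with-v ℚ.+_) (≡.trans (Σℚ.big-swap (allFin n) (splits M) _)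
         (Σℚ.big-cong (splits M) (λ s →
           sym (Σℚ.big-allLists-suc (allFin n) (length (proj₂ s)) (λ x → H (proj₁ s) (zip (v ∷ proj₂ s) x)))))) ⟩
  with-v ℚ.+
  Σℚ.big (splits M) (λ s → Σℚ.big (allLists (allFin n) (suc (length (proj₂ s)))) (λ x → H (proj₁ s) (zip (v ∷ proj₂ s) x)))
    ≡⟨ sym (big-splits-∷ v M _) ⟩
  Σℚ.big (splits (v ∷ M)) (λ s → Σℚ.big (allLists (allFin n) (length (proj₂ s))) (λ x → H (proj₁ s) (zip (proj₂ s) x))) ∎
  where
  words = allLists (allFin (suc n)) (length M)
  with-v = Σℚ.big (splits M) (λ s →
    Σℚ.big (allLists (allFin n) (length (proj₂ s))) (λ x → H (v ∷ proj₁ s) (zip (proj₂ s) x)))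

module _ {A : Set} (_≟_ : DecidableEquality A) where
  open Matching _≟_

  convolve-labellings : (F : List A → ℚ) (n : ℕ) (M : List A) →
    convolve F n M ≡
    Σℚ.big (allLists (allFin n) (length M)) (λ x → Πℚ.big (allFin n) (λ p → F (fibre p (zip M x))))
  convolve-labellings F zero [] = refl
  convolve-labellings F zero (_ ∷ _) = refl
  convolve-labellings F (suc n) M = begin
    Σℚ.big (splits M) (λ s → F (proj₁ s) ℚ.* convolve F n (proj₂ s))
      ≡⟨ Σℚ.big-cong (splits M) (λ s → ≡.trans (cong (F (proj₁ s) ℚ.*_) (convolve-labellings F n (proj₂ s)))
           (*-big (F (proj₁ s)) (allLists (allFin n) (length (proj₂ s))) _)) ⟩
    Σℚ.big (splits M) (λ s → Σℚ.big (allLists (allFin n) (length (proj₂ s))) (λ x →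
      F (proj₁ s) ℚ.* Πℚ.big (allFin n) (λ p → F (fibre p (zip (proj₂ s) x)))))
      ≡⟨ sym (big-labellings n M (λ A z → F A ℚ.* Πℚ.big (allFin n) (λ p → F (fibre p z)))) ⟩
    Σℚ.big (allLists (allFin (suc n)) (length M)) (λ x →
      F (fibre zero (zip M x)) ℚ.* Πℚ.big (allFin n) (λ p → F (fibre p (lowerLabels (zip M x)))))
      ≡⟨ Σℚ.big-cong (allLists (allFin (suc n)) (length M)) (λ x → sym (≡.trans (Πℚ.big-allFin-suc n (λ p → F (fibre p (zip M x))))
           (cong (F (fibre zero (zip M x)) ℚ.*_)
             (Πℚ.big-cong (allFin n) (λ p → cong F (fibre-suc p (zip M x))))))) ⟩
    Σℚ.big (allLists (allFin (suc n)) (length M)) (λ x →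
      Πℚ.big (allFin (suc n)) (λ p → F (fibre p (zip M x)))) ∎

-- Coefficients as derivatives at zero

count-∷ : {A : Set} (p : A → Bool) (x : A) (xs : List A) → countB p (x ∷ xs) ≡ bit (p x) ℕ.+ countB p xs
count-∷ p x xs with p x
... | true = refl
... | false = refl

module _ {A : Set} (_≟_ : DecidableEquality A) where

  count-∈ : ∀ {v} T → countB (λ u → ⌊ v ≟ u ⌋) T ≢ 0 → v ∈ T
  count-∈ [] c = contradiction refl c
  count-∈ {v} (u ∷ T) c with v ≟ u
  ... | yes refl = here refl
  ... | no _ = there (count-∈ T c)

  counts⇒↭ : ∀ T M → (∀ v → countB (λ u → ⌊ v ≟ u ⌋) T ≡ countB (λ u → ⌊ v ≟ u ⌋) M) → T ↭ M
  counts⇒↭ [] [] e = refl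
  counts⇒↭ [] (u ∷ M) e with e u
  ... | e′ rewrite ⌊⌋-refl _≟_ u = contradiction e′ λ ()
  counts⇒↭ (v ∷ T) M e with ∈-∃++ (count-∈ M nonzero)
    where
    nonzero : countB (λ u → ⌊ v ≟ u ⌋) M ≢ 0
    nonzero z with ≡.trans (e v) z
    ... | e′ rewrite ⌊⌋-refl _≟_ v = contradiction e′ λ ()
  ... | M₁ , M₂ , refl = trans (prep v (counts⇒↭ T (M₁ ++ M₂) rest)) (↭-sym (shift v M₁ M₂))
    where
    rest : ∀ w → countB (λ u → ⌊ w ≟ u ⌋) T ≡ countB (λ u → ⌊ w ≟ u ⌋) (M₁ ++ M₂)
    rest w = ℕₚ.+-cancelˡ-≡ (bit ⌊ w ≟ v ⌋) _ _ (begin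
      bit ⌊ w ≟ v ⌋ ℕ.+ countB (λ u → ⌊ w ≟ u ⌋) T  ≡⟨ sym (count-∷ _ v T) ⟩
      countB (λ u → ⌊ w ≟ u ⌋) (v ∷ T)              ≡⟨ e w ⟩
      countB (λ u → ⌊ w ≟ u ⌋) (M₁ ++ v ∷ M₂)       ≡⟨ count-↭ _ (shift v M₁ M₂) ⟩
      countB (λ u → ⌊ w ≟ u ⌋) (v ∷ M₁ ++ M₂)       ≡⟨ count-∷ _ v (M₁ ++ M₂) ⟩
      bit ⌊ w ≟ v ⌋ ℕ.+ countB (λ u → ⌊ w ≟ u ⌋) (M₁ ++ M₂) ∎)

infix 4 _≟C_
_≟C_ : {N d : ℕ} → DecidableEquality (Col N d)
_≟C_ = Vecₚ.≡-dec _≟F_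

allCols : (N d : ℕ) → List (Col N d)
allCols N d = allVecs (allFin N) d

once-allCols : (N d : ℕ) (c : Col N d) → countB (eqCol c) (allCols N d) ≡ 1
once-allCols N d = once-allVecs _≟F_ (allFin N) (once-allFin N)

module _ {N d : ℕ} where

  open Matching (_≟C_ {N} {d}) public

  -- `sameMon` compares counts only at variables that occur in one of the two lists. At every other
  -- variable both counts are zero.
  sameMon⇒↭ : (T M : Monomial N d) → sameMon T M ≡ true → T ↭ M
  sameMon⇒↭ T M e = counts⇒↭ _≟C_ T M counts
    where
    listed : ∀ {v} → v ∈ T ++ M → countB (eqCol v) T ≡ countB (eqCol v) M
    listed v∈ = ≡ᵇ-true⁻ (allB-true⁻ _ (T ++ M) e v∈)
    counts : ∀ v → countB (eqCol v) T ≡ countB (eqCol v) M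
    counts v with countB (eqCol v) T ℕ.≟ 0 | countB (eqCol v) M ℕ.≟ 0
    ... | yes t | yes m = ≡.trans t (sym m)
    ... | no t | _ = listed (∈-++⁺ˡ (count-∈ _≟C_ T t))
    ... | _ | no m = listed (∈-++⁺ʳ T (count-∈ _≟C_ M m))

  ↭⇒sameMon : {T M : Monomial N d} → T ↭ M → sameMon T M ≡ true
  ↭⇒sameMon {T} {M} T↭M = allB-true⁺ _ (T ++ M) (λ {v} _ → ≡ᵇ-true⁺ (count-↭ (eqCol v) T↭M))

  -- Prepending `v` changes only the factor of the column `v`, where r! becomes (r+1)!.
  normT-multiplicity : (M : Monomial N d) → normT M ≡ multiplicity M
  normT-multiplicity [] = Πℕ.big-ε (allCols N d)
  normT-multiplicity (v ∷ M) = begin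
    Πℕ.big (allCols N d) (λ c → countB (eqCol c) (v ∷ M) !)
      ≡⟨ Πℕ.big-cong (allCols N d) factor ⟩
    Πℕ.big (allCols N d) (λ c → (if eqCol v c then suc (countB (eqCol c) M) else 1) ℕ.* (countB (eqCol c) M !))
      ≡⟨ Πℕ.big-∙ (allCols N d) _ _ ⟩
    Πℕ.big (allCols N d) (λ c → if eqCol v c then suc (countB (eqCol c) M) else 1) ℕ.* normT M
      ≡⟨ cong₂ ℕ._*_ (Πℕ.big-single _≟C_ v (allCols N d) _ (once-allCols N d v)) (normT-multiplicity M) ⟩
    multiplicity (v ∷ M) ∎
    where
    factor : ∀ c → countB (eqCol c) (v ∷ M) ! ≡
      (if eqCol v c then suc (countB (eqCol c) M) else 1) ℕ.* (countB (eqCol c) M !)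
    factor c rewrite ⌊⌋-sym _≟C_ v c with eqCol c v
    ... | true = refl
    ... | false = sym (ℕₚ.*-identityˡ _)

  multiplicity-nonZero : (M : Monomial N d) → ℕ.NonZero (multiplicity M)
  multiplicity-nonZero [] = _
  multiplicity-nonZero (v ∷ M) =
    ℕₚ.m*n≢0 (suc (countB (eqCol v) M)) (multiplicity M) {{_}} {{multiplicity-nonZero M}}

  normT-nonZero : (M : Monomial N d) → ℕ.NonZero (normT M)
  normT-nonZero M = ≡.subst ℕ.NonZero (sym (normT-multiplicity M)) (multiplicity-nonZero M)

  deriv : Monomial N d → Poly N d → ℚ
  deriv M P = Σℚ.big P (λ t → proj₁ t ℚ.* match M (proj₂ t))

  -- `match M` is at once the test for being a rearrangement of `M` and the weight ‖M‖ of a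
  -- successful test.
  normT-coeff : (P : Poly N d) (M : Monomial N d) → ι (normT M) ℚ.* coeff P M ≡ deriv M P
  normT-coeff P M = ≡.trans (*-big (ι (normT M)) P _) (Σℚ.big-cong P term)
    where
    term : ∀ t → ι (normT M) ℚ.* (if sameMon (proj₂ t) M then proj₁ t else 0ℚ) ≡ proj₁ t ℚ.* match M (proj₂ t)
    term (q , T) with sameMon T M in same
    ... | true = ≡.trans (ℚₚ.*-comm (ι (normT M)) q) (cong (q ℚ.*_)
            (≡.trans (cong ι (normT-multiplicity M)) (sym (match-↭ M T (sameMon⇒↭ T M same)))))
    ... | false = ≡.trans (ℚₚ.*-zeroʳ (ι (normT M))) (sym (≡.trans (cong (q ℚ.*_) (match-≁ M T T≁M)) (ℚₚ.*-zeroʳ q)))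
      where
      T≁M : ¬ (T ↭ M)
      T≁M T↭M = contradiction (≡.trans (sym same) (↭⇒sameMon T↭M)) λ ()

  coeff-deriv : (P : Poly N d) (M : Monomial N d) → coeff P M ≡ deriv M P ℚ.* recipℕ (normT M)
  coeff-deriv P M = begin
    coeff P M                                             ≡⟨ sym (ℚₚ.*-identityʳ _) ⟩
    coeff P M ℚ.* 1ℚ                                      ≡⟨ cong (coeff P M ℚ.*_) (sym (recipℕ-inverseʳ (normT M) {{normT-nonZero M}})) ⟩
    coeff P M ℚ.* (ι (normT M) ℚ.* recipℕ (normT M))      ≡⟨ sym (ℚₚ.*-assoc (coeff P M) (ι (normT M)) _) ⟩
    coeff P M ℚ.* ι (normT M) ℚ.* recipℕ (normT M)        ≡⟨ cong (ℚ._* recipℕ (normT M)) (≡.trans (ℚₚ.*-comm (coeff P M) (ι (normT M))) (normT-coeff P M)) ⟩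
    deriv M P ℚ.* recipℕ (normT M)                        ∎

  deriv-*P : (P Q : Poly N d) (M : Monomial N d) →
    deriv M (P *P Q) ≡ Σℚ.big (splits M) (λ s → deriv (proj₁ s) P ℚ.* deriv (proj₂ s) Q)
  deriv-*P P Q M = begin
    deriv M (P *P Q)
      ≡⟨ Σℚ.big-concatMap _ P _ ⟩
    Σℚ.big P (λ s → Σℚ.big (map (λ t → (proj₁ s ℚ.* proj₁ t , proj₂ s ++ proj₂ t)) Q)
      (λ t → proj₁ t ℚ.* match M (proj₂ t)))
      ≡⟨ Σℚ.big-cong P (λ s → Σℚ.big-map _ Q _) ⟩
    Σℚ.big P (λ s → Σℚ.big Q (λ t → proj₁ s ℚ.* proj₁ t ℚ.* match M (proj₂ s ++ proj₂ t)))
      ≡⟨ Σℚ.big-cong P (λ s → Σℚ.big-cong Q (λ t → leibniz s t)) ⟩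
    Σℚ.big P (λ s → Σℚ.big Q (λ t → Σℚ.big (splits M) (λ a → left s a ℚ.* right t a)))
      ≡⟨ Σℚ.big-cong P (λ s → Σℚ.big-swap Q (splits M) _) ⟩
    Σℚ.big P (λ s → Σℚ.big (splits M) (λ a → Σℚ.big Q (λ t → left s a ℚ.* right t a)))
      ≡⟨ Σℚ.big-swap P (splits M) _ ⟩
    Σℚ.big (splits M) (λ a → Σℚ.big P (λ s → Σℚ.big Q (λ t → left s a ℚ.* right t a)))
      ≡⟨ Σℚ.big-cong (splits M) (λ a → Σℚ.big-cong P (λ s → sym (*-big (left s a) Q (λ t → right t a)))) ⟩
    Σℚ.big (splits M) (λ a → Σℚ.big P (λ s → left s a ℚ.* deriv (proj₂ a) Q))
      ≡⟨ Σℚ.big-cong (splits M) (λ a → sym (big-* P (λ s → left s a) (deriv (proj₂ a) Q))) ⟩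
    Σℚ.big (splits M) (λ a → deriv (proj₁ a) P ℚ.* deriv (proj₂ a) Q) ∎
    where
    left right : ℚ × Monomial N d → Monomial N d × Monomial N d → ℚ
    left s a = proj₁ s ℚ.* match (proj₁ a) (proj₂ s)
    right t a = proj₁ t ℚ.* match (proj₂ a) (proj₂ t)
    leibniz : ∀ s t → proj₁ s ℚ.* proj₁ t ℚ.* match M (proj₂ s ++ proj₂ t) ≡
      Σℚ.big (splits M) (λ a → left s a ℚ.* right t a)
    leibniz s t = begin
      proj₁ s ℚ.* proj₁ t ℚ.* match M (proj₂ s ++ proj₂ t)
        ≡⟨ cong (proj₁ s ℚ.* proj₁ t ℚ.*_) (match-++ M (proj₂ s) (proj₂ t)) ⟩
      proj₁ s ℚ.* proj₁ t ℚ.* Σℚ.big (splits M) (λ a → match (proj₁ a) (proj₂ s) ℚ.* match (proj₂ a) (proj₂ t))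
        ≡⟨ *-big (proj₁ s ℚ.* proj₁ t) (splits M) _ ⟩
      Σℚ.big (splits M) (λ a → proj₁ s ℚ.* proj₁ t ℚ.* (match (proj₁ a) (proj₂ s) ℚ.* match (proj₂ a) (proj₂ t)))
        ≡⟨ Σℚ.big-cong (splits M) (λ a → ℚ*.interchange (proj₁ s) (proj₁ t) (match (proj₁ a) (proj₂ s)) (match (proj₂ a) (proj₂ t))) ⟩
      Σℚ.big (splits M) (λ a → left s a ℚ.* right t a) ∎

  deriv-^P : (P : Poly N d) (n : ℕ) (M : Monomial N d) → deriv M (P ^P n) ≡ convolve (λ A → deriv A P) n M
  deriv-^P P zero M = ≡.trans (ℚₚ.+-identityʳ _) (ℚₚ.*-identityˡ _)
  deriv-^P P (suc n) M = ≡.trans (deriv-*P P (P ^P n) M)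
    (Σℚ.big-cong (splits M) (λ s → cong (deriv (proj₁ s) P ℚ.*_) (deriv-^P P n (proj₂ s))))

-- Signs of words

-- Where `isPerm` lets the length of the word decide which letters must occur, this asks for every
-- letter of `Fin k`. Words of another length thus fail, and on length `k` the two tests agree.
isPermFin : {k : ℕ} → List (Fin k) → Bool
isPermFin {k} w = allB (λ c → countB (λ b → ⌊ c ≟F b ⌋) w ≡ᵇ 1) (allFin k)

sgnFin : {k : ℕ} → List (Fin k) → ℤ
sgnFin w = if isPermFin w then signW (finsToℕ w) else + 0

isPermFin-once : {k : ℕ} (w : List (Fin k)) → isPermFin w ≡ true → ∀ c → countB (λ b → ⌊ c ≟F b ⌋) w ≡ 1
isPermFin-once {k} w e c = ≡ᵇ-true⁻ (allB-true⁻ _ (allFin k) e (∈-allFin c))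

length-isPermFin : {k : ℕ} (w : List (Fin k)) → isPermFin w ≡ true → length w ≡ k
length-isPermFin {k} w e = begin
  length w                          ≡⟨ length-big w ⟩
  Σℕ.big w (λ _ → 1)                ≡⟨ Σℕ.big-once _≟F_ (allFin k) w (once-allFin k) (isPermFin-once w e) _ ⟩
  Σℕ.big (allFin k) (λ _ → 1)       ≡⟨ sym (length-big (allFin k)) ⟩
  length (allFin k)                 ≡⟨ Listₚ.length-tabulate (λ i → i) ⟩
  k                                 ∎

allB-cong : {p q : A → Bool} (xs : List A) → (∀ x → p x ≡ q x) → allB p xs ≡ allB q xs
allB-cong {p = p} {q} xs e = ≡.trans (allB-big p xs) (≡.trans (⋀.big-cong xs e) (sym (allB-big q xs)))

map-toℕ-allFin : (n : ℕ) → map toℕ (allFin n) ≡ upTo n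
map-toℕ-allFin n = ≡.trans (Listₚ.map-tabulate (λ i → i) toℕ) (go n (λ i → i))
  where
  go : ∀ n (f : ℕ → ℕ) → List.tabulate {n = n} (f ∘ toℕ) ≡ List.applyUpTo f n
  go zero f = refl
  go (suc n) f = cong (f 0 ∷_) (go n (f ∘ suc))

toℕ-≡ᵇ : {k : ℕ} (b c : Fin k) → (toℕ b ≡ᵇ toℕ c) ≡ ⌊ c ≟F b ⌋
toℕ-≡ᵇ b c with c ≟F b
... | yes refl = ≡ᵇ-true⁺ {toℕ b} refl
... | no c≢b with toℕ b ≡ᵇ toℕ c in e
...   | false = refl
...   | true = contradiction (sym (toℕ-injective (≡ᵇ-true⁻ e))) c≢b

isPerm-finsToℕ : {k : ℕ} (w : List (Fin k)) → length w ≡ k → isPerm (finsToℕ w) ≡ isPermFin w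
isPerm-finsToℕ {k} w len = begin
  allB test (upTo (length (finsToℕ w)))
    ≡⟨ cong (allB test) (≡.trans (cong upTo (≡.trans (Listₚ.length-map toℕ w) len)) (sym (map-toℕ-allFin k))) ⟩
  allB test (map toℕ (allFin k))
    ≡⟨ ≡.trans (allB-big _ (map toℕ (allFin k))) (⋀.big-map toℕ (allFin k) _) ⟩
  ⋀.big (allFin k) (test ∘ toℕ)
    ≡⟨ sym (allB-big _ (allFin k)) ⟩
  allB (test ∘ toℕ) (allFin k)
    ≡⟨ allB-cong (allFin k) (λ c → cong (_≡ᵇ 1)
         (≡.trans (count-map _ toℕ w) (count-cong w (λ b → toℕ-≡ᵇ b c)))) ⟩
  isPermFin w ∎
  where
  test : ℕ → Bool
  test j = countB (λ b → b ≡ᵇ j) (finsToℕ w) ≡ᵇ 1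

psgn-finsToℕ : {k : ℕ} (w : List (Fin k)) → length w ≡ k → psgn (finsToℕ w) ≡ sgnFin w
psgn-finsToℕ w len = cong (if_then signW (finsToℕ w) else + 0) (isPerm-finsToℕ w len)

<ᵇ-true : ∀ {m n} → m ℕ.< n → (m <ᵇ n) ≡ true
<ᵇ-true m<n = Equivalence.to Boolₚ.T-≡ (ℕₚ.<⇒<ᵇ m<n)

<ᵇ-false : ∀ {m n} → ¬ (m ℕ.< n) → (m <ᵇ n) ≡ false
<ᵇ-false {m} {n} m≮n with m <ᵇ n in e
... | false = refl
... | true = contradiction (ℕₚ.<ᵇ⇒< m n (Equivalence.from Boolₚ.T-≡ e)) m≮n

-- Pairs involving a third position keep their relative order; only the exchanged pair itself
-- becomes an inversion.
inversions-swap : ∀ pre {a b} post → a ℕ.< b →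
  inversions (pre ++ b ∷ a ∷ post) ≡ suc (inversions (pre ++ a ∷ b ∷ post))
inversions-swap [] {a} {b} post a<b = begin
  countB (_<ᵇ b) (a ∷ post) ℕ.+ (countB (_<ᵇ a) post ℕ.+ inversions post)
    ≡⟨ cong (ℕ._+ (countB (_<ᵇ a) post ℕ.+ inversions post)) (≡.trans (count-∷ (_<ᵇ b) a post)
         (cong (λ t → bit t ℕ.+ countB (_<ᵇ b) post) (<ᵇ-true a<b))) ⟩
  suc (countB (_<ᵇ b) post ℕ.+ (countB (_<ᵇ a) post ℕ.+ inversions post))
    ≡⟨ cong suc (ℕ+.x∙yz≈y∙xz (countB (_<ᵇ b) post) (countB (_<ᵇ a) post) (inversions post)) ⟩
  suc (countB (_<ᵇ a) post ℕ.+ (countB (_<ᵇ b) post ℕ.+ inversions post))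
    ≡⟨ cong (λ t → suc (t ℕ.+ (countB (_<ᵇ b) post ℕ.+ inversions post))) (sym (≡.trans (count-∷ (_<ᵇ a) b post)
         (cong (λ t → bit t ℕ.+ countB (_<ᵇ a) post) (<ᵇ-false (ℕₚ.<-asym a<b))))) ⟩
  suc (inversions (a ∷ b ∷ post)) ∎
inversions-swap (x ∷ pre) {a} {b} post a<b = ≡.trans
  (cong₂ ℕ._+_ (count-↭ (_<ᵇ x) (++⁺ˡ pre (swap b a refl))) (inversions-swap pre post a<b))
  (ℕₚ.+-suc _ _)

signW-swap : ∀ pre {a b} post → a ℕ.< b → signW (pre ++ b ∷ a ∷ post) ≡ ℤ.- signW (pre ++ a ∷ b ∷ post)
signW-swap pre post a<b =
  ≡.trans (cong (ℤ.-1ℤ ℤ.^_) (inversions-swap pre post a<b)) (ℤₚ.-1*i≡-i _)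

isPermFin-↭ : {k : ℕ} {v w : List (Fin k)} → v ↭ w → isPermFin v ≡ isPermFin w
isPermFin-↭ {k} v↭w = allB-cong (allFin k) (λ c → cong (_≡ᵇ 1) (count-↭ _ v↭w))

isPermFin-repeat : {k : ℕ} (pre : List (Fin k)) (a : Fin k) (post : List (Fin k)) →
  isPermFin (pre ++ a ∷ a ∷ post) ≡ false
isPermFin-repeat pre a post with isPermFin (pre ++ a ∷ a ∷ post) in e
... | false = refl
... | true = contradiction (≡.trans (sym twice) (isPermFin-once (a ∷ a ∷ pre ++ post)
        (≡.trans (isPermFin-↭ (↭-sym (shifts pre (a ∷ a ∷ [])))) e) a)) λ ()
  where
  twice : countB (λ b → ⌊ a ≟F b ⌋) (a ∷ a ∷ pre ++ post) ≡ suc (suc (countB (λ b → ⌊ a ≟F b ⌋) (pre ++ post)))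
  twice = ≡.trans (count-self _≟F_ a (a ∷ pre ++ post)) (cong suc (count-self _≟F_ a (pre ++ post)))

sgnFin-swap : {k : ℕ} (pre : List (Fin k)) (a b : Fin k) (post : List (Fin k)) →
  sgnFin (pre ++ a ∷ b ∷ post) ≡ ℤ.- sgnFin (pre ++ b ∷ a ∷ post)
sgnFin-swap pre a b post
  rewrite isPermFin-↭ (++⁺ˡ pre (swap {xs = post} b a refl))
        | Listₚ.map-++ toℕ pre (a ∷ b ∷ post) | Listₚ.map-++ toℕ pre (b ∷ a ∷ post)
  with ℕₚ.<-cmp (toℕ a) (toℕ b)
... | tri> _ _ b<a with isPermFin (pre ++ a ∷ b ∷ post)
...   | true = signW-swap (map toℕ pre) (map toℕ post) b<a
...   | false = refl
sgnFin-swap pre a b post | tri< a<b _ _ with isPermFin (pre ++ a ∷ b ∷ post)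
...   | true = ≡.trans (sym (ℤₚ.neg-involutive _)) (cong ℤ.-_ (sym (signW-swap (map toℕ pre) (map toℕ post) a<b)))
...   | false = refl
-- Equal neighbours: both words repeat a letter, so both signs are zero.
sgnFin-swap pre a b post | tri≈ _ a≡b _ with toℕ-injective a≡b
... | refl rewrite isPermFin-repeat pre a post = refl

Π-const-even : {d : ℕ} → 2 ∣ d → (u : ℤ) → u ℤ.* u ≡ + 1 → Πℤ.big (allFin d) (λ _ → u) ≡ + 1
Π-const-even {d} (divides q refl) u uu = begin
  Πℤ.big (allFin d) (λ _ → u)  ≡⟨ const (allFin d) ⟩
  u ℤ.^ length (allFin d)      ≡⟨ cong (u ℤ.^_) (≡.trans (Listₚ.length-tabulate {n = d} (λ i → i)) (ℕₚ.*-comm q 2)) ⟩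
  u ℤ.^ (2 ℕ.* q)              ≡⟨ sym (ℤₚ.^-*-assoc u 2 q) ⟩
  (u ℤ.^ 2) ℤ.^ q              ≡⟨ cong (ℤ._^ q) (≡.trans (cong (u ℤ.*_) (ℤₚ.*-identityʳ u)) uu) ⟩
  (+ 1) ℤ.^ q                  ≡⟨ ℤₚ.^-zeroˡ q ⟩
  + 1                          ∎
  where
  const : (xs : List A) → Πℤ.big xs (λ _ → u) ≡ u ℤ.^ length xs
  const [] = refl
  const (x ∷ xs) = cong (u ℤ.*_) (const xs)

-- Evenness of `d` acts through this: a sign common to all rows cancels in pairs. It is applied to
-- the sign of a column swap and to the sign relating the two sortings of the grid.
Π-scale-even : {d : ℕ} → 2 ∣ d → (u : ℤ) → u ℤ.* u ≡ + 1 → (f : Fin d → ℤ) →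
  Πℤ.big (allFin d) (λ i → u ℤ.* f i) ≡ Πℤ.big (allFin d) f
Π-scale-even {d} even u uu f = ≡.trans (Πℤ.big-∙ (allFin d) (λ _ → u) f)
  (≡.trans (cong (ℤ._* Πℤ.big (allFin d) f) (Π-const-even even u uu)) (ℤₚ.*-identityˡ _))

-- Separates the permutation tests from the signs, so that the inversion counts can afterwards be
-- compared on their own.
Π-if : (xs : List A) (b : A → Bool) (f : A → ℤ) →
  Πℤ.big xs (λ x → if b x then f x else + 0) ≡ (if allB b xs then Πℤ.big xs f else + 0)
Π-if [] b f = refl
Π-if (x ∷ xs) b f with b x
... | false = ℤₚ.*-zeroˡ (Πℤ.big xs (λ x → if b x then f x else + 0))
... | true = ≡.trans (cong (f x ℤ.*_) (Π-if xs b f)) (push (allB b xs))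
  where
  push : ∀ c → f x ℤ.* (if c then Πℤ.big xs f else + 0) ≡ (if c then f x ℤ.* Πℤ.big xs f else + 0)
  push true = refl
  push false = ℤₚ.*-zeroʳ (f x)

-- The function F of the overview.
sgnRows : {k d : ℕ} → Table k d → ℤ
sgnRows {d = d} Y = Πℤ.big (allFin d) (λ i → sgnFin (row Y i))

sgnRows-symmetric : {k d : ℕ} → 2 ∣ d → AdjacentSymmetric {Col k d} (ℤtoℚ ∘ sgnRows)
sgnRows-symmetric {d = d} even pre a b post = cong ℤtoℚ (begin
  Πℤ.big (allFin d) (λ i → sgnFin (row (pre ++ a ∷ b ∷ post) i))
    ≡⟨ Πℤ.big-cong (allFin d) swapped ⟩
  Πℤ.big (allFin d) (λ i → ℤ.-1ℤ ℤ.* sgnFin (row (pre ++ b ∷ a ∷ post) i))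
    ≡⟨ Π-scale-even even ℤ.-1ℤ refl _ ⟩
  Πℤ.big (allFin d) (λ i → sgnFin (row (pre ++ b ∷ a ∷ post) i)) ∎)
  where
  swapped : ∀ i → sgnFin (row (pre ++ a ∷ b ∷ post) i) ≡ ℤ.-1ℤ ℤ.* sgnFin (row (pre ++ b ∷ a ∷ post) i)
  swapped i rewrite Listₚ.map-++ (λ c → lookup c i) pre (a ∷ b ∷ post)
                  | Listₚ.map-++ (λ c → lookup c i) pre (b ∷ a ∷ post) =
    ≡.trans (sgnFin-swap (row pre i) (lookup a i) (lookup b i) (row post i)) (sym (ℤₚ.-1*i≡-i _))

-- A single row whose length is not `k` already kills the product; the dimension has the form
-- `suc d` so that there is such a row.
sgnRows-length : {k d : ℕ} (Y : Table k (suc d)) → length Y ≢ k → sgnRows Y ≡ + 0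
sgnRows-length {k} {d} Y len = ≡.trans (Π-if (allFin (suc d)) (isPermFin ∘ row Y) _) vanish
  where
  vanish : (if allB (isPermFin ∘ row Y) (allFin (suc d)) then Πℤ.big (allFin (suc d)) (signW ∘ finsToℕ ∘ row Y) else + 0) ≡ + 0
  vanish with allB (isPermFin ∘ row Y) (allFin (suc d)) in e
  ... | false = refl
  ... | true = contradiction (≡.trans (sym (Listₚ.length-map _ Y))
          (length-isPermFin (row Y zero) (allB-true⁻ (isPermFin ∘ row Y) (allFin (suc d)) e (∈-allFin zero)))) len

toList-columns : {a b : ℕ} (W : Vec (Vec A a) b) →
  Vec.toList (columns W) ≡ map (λ i → Vec.map (λ w → lookup w i) W) (allFin a)
toList-columns {a = a} W = begin
  Vec.toList (columns W)
    ≡⟨ cong Vec.toList (sym (Vecₚ.tabulate∘lookup (columns W))) ⟩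
  Vec.toList (Vec.tabulate (lookup (columns W)))
    ≡⟨ cong Vec.toList (Vecₚ.tabulate-cong (column W)) ⟩
  Vec.toList (Vec.tabulate (λ i → Vec.map (λ w → lookup w i) W))
    ≡⟨ go a (λ i → Vec.map (λ w → lookup w i) W) ⟩
  List.tabulate (λ i → Vec.map (λ w → lookup w i) W)
    ≡⟨ sym (Listₚ.map-tabulate (λ i → i) (λ i → Vec.map (λ w → lookup w i) W)) ⟩
  map (λ i → Vec.map (λ w → lookup w i) W) (allFin a) ∎
  where
  go : ∀ n (f : Fin n → A) → Vec.toList (Vec.tabulate f) ≡ List.tabulate f
  go zero f = refl
  go (suc n) f = cong (f zero ∷_) (go n (f ∘ suc))
  column : ∀ {a b} (W : Vec (Vec A a) b) i → lookup (columns W) i ≡ Vec.map (λ w → lookup w i) W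
  column [] i = Vecₚ.lookup-replicate i []
  column (w ∷ W) i = ≡.trans (Vecₚ.lookup-zipWith _∷_ i w (columns W)) (cong (lookup w i ∷_) (column W i))

row-columns : {k d : ℕ} (W : Vec (Vec (Fin k) k) d) (i : Fin d) →
  row (Vec.toList (columns W)) i ≡ Vec.toList (lookup W i)
row-columns W i = ≡.trans (sym (Vecₚ.toList-map (λ c → lookup c i) (columns W))) (cong Vec.toList (go W i))
  where
  go : ∀ {a b} (W : Vec (Vec A a) b) i → Vec.map (λ c → lookup c i) (columns W) ≡ lookup W i
  go (w ∷ W) zero = heads w (columns W)
    where
    heads : ∀ {a b} (w : Vec A a) (Y : Vec (Vec A b) a) → Vec.map (λ c → lookup c zero) (Vec.zipWith _∷_ w Y) ≡ w
    heads [] [] = refl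
    heads (x ∷ w) (_ ∷ Y) = cong (x ∷_) (heads w Y)
  go (w ∷ W) (suc i) = ≡.trans (tails w (columns W)) (go W i)
    where
    tails : ∀ {a} (w : Vec A a) (Y : Vec (Vec A _) a) →
      Vec.map (λ c → lookup c (suc i)) (Vec.zipWith _∷_ w Y) ≡ Vec.map (λ c → lookup c i) Y
    tails [] [] = refl
    tails (x ∷ w) (y ∷ Y) = cong (lookup y i ∷_) (tails w Y)

-- The derivatives of powers of the hyperdeterminant

big-allFin-lookup : {n : ℕ} (v : Vec A n) (f : A → ℤ) → Πℤ.big (allFin n) (λ i → f (lookup v i)) ≡ Πℤ.big (Vec.toList v) f
big-allFin-lookup [] f = refl
big-allFin-lookup {n = suc n} (a ∷ v) f = ≡.trans (Πℤ.big-allFin-suc n (λ i → f (lookup (a ∷ v) i)))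
  (cong (f a ℤ.*_) (big-allFin-lookup v f))

-- The right-hand side is the sign product in a term of `hyperdet`, extended by zero to tuples of
-- arbitrary words; the left-hand side sees the same tuple through its columns.
sgnRows-columns : {k d : ℕ} (W : Vec (Vec (Fin k) k) d) →
  sgnRows (Vec.toList (columns W)) ≡
  (if allB (λ π → isPerm (finsToℕ (Vec.toList π))) (Vec.toList W) then prodℤ (map permSign (Vec.toList W)) else + 0)
sgnRows-columns {k} {d} W = begin
  Πℤ.big (allFin d) (λ i → sgnFin (row (Vec.toList (columns W)) i))
    ≡⟨ Πℤ.big-cong (allFin d) (λ i → cong sgnFin (row-columns W i)) ⟩
  Πℤ.big (allFin d) (λ i → sgnFin (Vec.toList (lookup W i)))
    ≡⟨ big-allFin-lookup W (λ π → sgnFin (Vec.toList π)) ⟩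
  Πℤ.big (Vec.toList W) (λ π → sgnFin (Vec.toList π))
    ≡⟨ Πℤ.big-cong (Vec.toList W) (λ π → sym (psgn-finsToℕ (Vec.toList π) (Vecₚ.length-toList π))) ⟩
  Πℤ.big (Vec.toList W) (λ π → psgn (finsToℕ (Vec.toList π)))
    ≡⟨ Π-if (Vec.toList W) (λ π → isPerm (finsToℕ (Vec.toList π))) permSign ⟩
  _ ∎

-- Since `sgnRows` vanishes on non-permutations, the sum may run over all tables of `k` columns.
-- Symmetry then collapses it by `big-match` to k! times `sgnRows M`.
deriv-hyperdet : {k d : ℕ} → 2 ∣ suc d → (M : Monomial k (suc d)) → deriv M (hyperdet (suc d) k) ≡ ℤtoℚ (sgnRows M)
deriv-hyperdet {k} {d₀} even M = begin
  deriv M (hyperdet d k)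
    ≡⟨ Σℚ.big-map _ (allVecs (perms k) d) _ ⟩
  Σℚ.big (allVecs (perms k) d) (λ W →
    ℤtoℚ (prodℤ (map permSign (Vec.toList W))) ℚ.* recipℕ (k !) ℚ.* match M (map (λ i → Vec.map (λ π → lookup π i) W) (allFin k)))
    ≡⟨ Σℚ.big-allVecs-filterᵇ (λ π → isPerm (finsToℕ (Vec.toList π))) (allVecs (allFin k) k) d _ ⟩
  Σℚ.big (allVecs (allVecs (allFin k) k) d) (λ W →
    if allB (λ π → isPerm (finsToℕ (Vec.toList π))) (Vec.toList W)
    then ℤtoℚ (prodℤ (map permSign (Vec.toList W))) ℚ.* recipℕ (k !) ℚ.* match M (map (λ i → Vec.map (λ π → lookup π i) W) (allFin k))
    else 0ℚ)
    ≡⟨ Σℚ.big-cong (allVecs (allVecs (allFin k) k) d) term ⟩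
  Σℚ.big (allVecs (allVecs (allFin k) k) d) (λ W → summand (Vec.toList (columns W)))
    ≡⟨ Σℚ.big-columns (allFin k) k d (summand ∘ Vec.toList) ⟩
  Σℚ.big (allVecs (allCols k d) k) (summand ∘ Vec.toList)
    ≡⟨ total ⟩
  ℤtoℚ (sgnRows M) ∎
  where
  d = suc d₀
  summand : Monomial k d → ℚ
  summand Y = ℤtoℚ (sgnRows Y) ℚ.* recipℕ (k !) ℚ.* match M Y
  term : ∀ W → _ ≡ summand (Vec.toList (columns W))
  term W = sym (≡.trans (cong₂ (λ s Y → ℤtoℚ s ℚ.* recipℕ (k !) ℚ.* match M Y) (sgnRows-columns W) (toList-columns W))
    (push (allB (λ π → isPerm (finsToℕ (Vec.toList π))) (Vec.toList W))))
    where
    T = map (λ i → Vec.map (λ π → lookup π i) W) (allFin k)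
    push : ∀ b {s} → ℤtoℚ (if b then s else + 0) ℚ.* recipℕ (k !) ℚ.* match M T ≡
      (if b then ℤtoℚ s ℚ.* recipℕ (k !) ℚ.* match M T else 0ℚ)
    push true = refl
    push false = ≡.trans (cong (ℚ._* match M T) (ℚₚ.*-zeroˡ (recipℕ (k !)))) (ℚₚ.*-zeroˡ (match M T))
  matching-length : ∀ m → length M ≡ m →
    Σℚ.big (allLists (allCols k d) m) (λ Y → ℤtoℚ (sgnRows Y) ℚ.* match M Y) ≡ ι (m !) ℚ.* ℤtoℚ (sgnRows M)
  matching-length _ refl = big-match (allCols k d) (once-allCols k d) (sgnRows-symmetric even) M
  total : Σℚ.big (allVecs (allCols k d) k) (summand ∘ Vec.toList) ≡ ℤtoℚ (sgnRows M)
  total with length M ℕ.≟ k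
  -- In the wrong degree no table of `k` columns is a rearrangement of `M`, and `sgnRows M` vanishes
  -- as well.
  ... | no len = ≡.trans
    (≡.trans (Σℚ.big-cong (allVecs (allCols k d) k) (λ Y → ≡.trans
      (cong (ℤtoℚ (sgnRows (Vec.toList Y)) ℚ.* recipℕ (k !) ℚ.*_) (match-≁ M (Vec.toList Y)
        (λ Y↭M → len (≡.trans (sym (↭-length Y↭M)) (Vecₚ.length-toList Y)))))
      (ℚₚ.*-zeroʳ (ℤtoℚ (sgnRows (Vec.toList Y)) ℚ.* recipℕ (k !))))) (Σℚ.big-ε (allVecs (allCols k d) k)))
    (sym (cong ℤtoℚ (sgnRows-length M len)))
  ... | yes len = begin
    Σℚ.big (allVecs (allCols k d) k) (summand ∘ Vec.toList)
      ≡⟨ sym (Σℚ.big-allLists (allCols k d) k summand) ⟩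
    Σℚ.big (allLists (allCols k d) k) summand
      ≡⟨ Σℚ.big-cong (allLists (allCols k d) k) (λ Y → ≡.trans
           (cong (ℚ._* match M Y) (ℚₚ.*-comm (ℤtoℚ (sgnRows Y)) (recipℕ (k !))))
           (ℚₚ.*-assoc (recipℕ (k !)) (ℤtoℚ (sgnRows Y)) (match M Y))) ⟩
    Σℚ.big (allLists (allCols k d) k) (λ Y → recipℕ (k !) ℚ.* (ℤtoℚ (sgnRows Y) ℚ.* match M Y))
      ≡⟨ sym (*-big (recipℕ (k !)) (allLists (allCols k d) k) _) ⟩
    recipℕ (k !) ℚ.* Σℚ.big (allLists (allCols k d) k) (λ Y → ℤtoℚ (sgnRows Y) ℚ.* match M Y)
      ≡⟨ cong (recipℕ (k !) ℚ.*_) (matching-length k len) ⟩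
    recipℕ (k !) ℚ.* (ι (k !) ℚ.* ℤtoℚ (sgnRows M))
      ≡⟨ sym (ℚₚ.*-assoc (recipℕ (k !)) (ι (k !)) (ℤtoℚ (sgnRows M))) ⟩
    recipℕ (k !) ℚ.* ι (k !) ℚ.* ℤtoℚ (sgnRows M)
      ≡⟨ cong (ℚ._* ℤtoℚ (sgnRows M)) (≡.trans (ℚₚ.*-comm (recipℕ (k !)) (ι (k !))) (recipℕ-inverseʳ (k !) {{ℕₚ._!≢0 k}})) ⟩
    1ℚ ℚ.* ℤtoℚ (sgnRows M)
      ≡⟨ ℚₚ.*-identityˡ (ℤtoℚ (sgnRows M)) ⟩
    ℤtoℚ (sgnRows M) ∎

deriv-hyperdet^ : {k d : ℕ} → 2 ∣ suc d → (n : ℕ) (M : Monomial k (suc d)) →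
  deriv M (hyperdet (suc d) k ^P n) ≡
  Σℚ.big (allLists (allFin n) (length M)) (λ x → Πℚ.big (allFin n) (λ p → ℤtoℚ (sgnRows (fibre p (zip M x)))))
deriv-hyperdet^ {k} {d} even n M = ≡.trans (deriv-^P (hyperdet (suc d) k) n M)
  (≡.trans (convolve-labellings _≟C_ (λ A → deriv A (hyperdet (suc d) k)) n M)
    (Σℚ.big-cong (allLists (allFin n) (length M)) (λ x → Πℚ.big-cong (allFin n) (λ p →
      deriv-hyperdet even (fibre p (zip M x))))))

-- Exchanging rows and columns of a grid

-- Puts inversion counts of different words read off the same list of cells into one additive form,
-- so that they can be compared pair by pair.
pairSum : (A → A → ℕ) → List A → ℕ
pairSum θ [] = 0
pairSum θ (a ∷ z) = Σℕ.big z (θ a) ℕ.+ pairSum θ z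

pairSum-cong : {θ η : A → A → ℕ} → (∀ a b → θ a b ≡ η a b) → (z : List A) → pairSum θ z ≡ pairSum η z
pairSum-cong e [] = refl
pairSum-cong e (a ∷ z) = cong₂ ℕ._+_ (Σℕ.big-cong z (e a)) (pairSum-cong e z)

pairSum-+ : (θ η : A → A → ℕ) (z : List A) → pairSum (λ a b → θ a b ℕ.+ η a b) z ≡ pairSum θ z ℕ.+ pairSum η z
pairSum-+ θ η [] = refl
pairSum-+ θ η (a ∷ z) = ≡.trans (cong₂ ℕ._+_ (Σℕ.big-∙ z (θ a) (η a)) (pairSum-+ θ η z))
  (lemma (Σℕ.big z (θ a)) (Σℕ.big z (η a)) (pairSum θ z) (pairSum η z))
  where
  lemma : ∀ a b c d → (a ℕ.+ b) ℕ.+ (c ℕ.+ d) ≡ (a ℕ.+ c) ℕ.+ (b ℕ.+ d)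
  lemma = ℕSolver.solve-∀

-- The full double sum meets every pair of positions twice and the diagonal contributes nothing.
-- Consequently the pair sum of such a `θ` does not depend on the order of the list.
pairSum-symmetric : (θ : A → A → ℕ) → (∀ a b → θ a b ≡ θ b a) → (∀ a → θ a a ≡ 0) → (z : List A) →
  Σℕ.big z (λ a → Σℕ.big z (θ a)) ≡ 2 ℕ.* pairSum θ z
pairSum-symmetric θ θ-sym θ-irrefl [] = refl
pairSum-symmetric θ θ-sym θ-irrefl (a ∷ z) = begin
  (θ a a ℕ.+ X) ℕ.+ Σℕ.big z (λ b → θ b a ℕ.+ Σℕ.big z (θ b))
    ≡⟨ cong₂ ℕ._+_ (cong (ℕ._+ X) (θ-irrefl a)) (≡.trans (Σℕ.big-∙ z (λ b → θ b a) _)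
         (cong₂ ℕ._+_ (Σℕ.big-cong z (λ b → θ-sym b a)) (pairSum-symmetric θ θ-sym θ-irrefl z))) ⟩
  X ℕ.+ (X ℕ.+ 2 ℕ.* pairSum θ z)
    ≡⟨ lemma X (pairSum θ z) ⟩
  2 ℕ.* (X ℕ.+ pairSum θ z) ∎
  where
  X = Σℕ.big z (θ a)
  lemma : ∀ x p → x ℕ.+ (x ℕ.+ 2 ℕ.* p) ≡ 2 ℕ.* (x ℕ.+ p)
  lemma = ℕSolver.solve-∀

inversions-pairSum : (h : A → ℕ) (z : List A) → inversions (map h z) ≡ pairSum (λ a b → bit (h b <ᵇ h a)) z
inversions-pairSum h [] = refl
inversions-pairSum h (a ∷ z) = cong₂ ℕ._+_
  (≡.trans (count-map _ h z) (count-big _ z)) (inversions-pairSum h z)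

-- A pair of positions lies in a common part exactly when its keys agree, and then in the part of
-- that key only.
inversions-fibres : {k : ℕ} (key : A → Fin k) (h : A → ℕ) (z : List A) →
  Σℕ.big (allFin k) (λ c → inversions (map h (List.filterᵇ (λ a → ⌊ key a ≟F c ⌋) z))) ≡
  pairSum (λ a b → bit (⌊ key b ≟F key a ⌋ ∧ (h b <ᵇ h a))) z
inversions-fibres {k = k} key h [] = Σℕ.big-ε (allFin k)
inversions-fibres {k = k} key h (a ∷ z) = begin
  Σℕ.big (allFin k) (λ c → inversions (map h (part c (a ∷ z))))
    ≡⟨ Σℕ.big-cong (allFin k) head ⟩
  Σℕ.big (allFin k) (λ c → (if ⌊ key a ≟F c ⌋ then below c else 0) ℕ.+ inversions (map h (part c z)))
    ≡⟨ Σℕ.big-∙ (allFin k) _ _ ⟩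
  Σℕ.big (allFin k) (λ c → if ⌊ key a ≟F c ⌋ then below c else 0) ℕ.+
  Σℕ.big (allFin k) (λ c → inversions (map h (part c z)))
    ≡⟨ cong₂ ℕ._+_ (Σℕ.big-single _≟F_ (key a) (allFin k) below (once-allFin k (key a))) (inversions-fibres key h z) ⟩
  below (key a) ℕ.+ pairSum (λ a b → bit (⌊ key b ≟F key a ⌋ ∧ (h b <ᵇ h a))) z
    ≡⟨ cong (ℕ._+ _) (≡.trans (count-map _ h (part (key a) z))
         (≡.trans (count-filterᵇ _ (λ b → ⌊ key b ≟F key a ⌋) z) (count-big _ z))) ⟩
  pairSum (λ a b → bit (⌊ key b ≟F key a ⌋ ∧ (h b <ᵇ h a))) (a ∷ z) ∎
  where
  part : Fin k → List _ → List _
  part c = List.filterᵇ (λ a → ⌊ key a ≟F c ⌋)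
  below : Fin k → ℕ
  below c = countB (λ m → m <ᵇ h a) (map h (part c z))
  head : ∀ c → inversions (map h (part c (a ∷ z))) ≡
    (if ⌊ key a ≟F c ⌋ then below c else 0) ℕ.+ inversions (map h (part c z))
  head c with key a ≟F c
  ... | yes _ = refl
  ... | no _ = refl

-- Trichotomy as a relation between the three Boolean tests: one match fixes all three, so a
-- statement about two coordinates becomes nine computations.
data Order : (below equal above : Bool) → Set where
  lt : Order true false false
  eq : Order false true false
  gt : Order false false true

order : {k : ℕ} (a b : Fin k) → Order (toℕ b <ᵇ toℕ a) ⌊ b ≟F a ⌋ (toℕ a <ᵇ toℕ b)
order a b with ℕₚ.<-cmp (toℕ a) (toℕ b) | b ≟F a
... | tri< _ a≢b _ | yes refl = contradiction refl a≢b
... | tri> _ a≢b _ | yes refl = contradiction refl a≢b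
... | tri≈ _ a≡b _ | no b≢a = contradiction (sym (toℕ-injective a≡b)) b≢a
... | tri< a<b _ b≮a | no _ rewrite <ᵇ-true a<b | <ᵇ-false b≮a = gt
... | tri≈ a≮b _ b≮a | yes _ rewrite <ᵇ-false a≮b | <ᵇ-false b≮a = eq
... | tri> a≮b _ b<a | no _ rewrite <ᵇ-true b<a | <ᵇ-false a≮b = lt

module _ {k n : ℕ} where

  Cell : Set
  Cell = Fin k × Fin n

  _≟×_ : DecidableEquality Cell
  _≟×_ = ×ₚ.≡-dec _≟F_ _≟F_

  fstℕ sndℕ : Cell → ℕ
  fstℕ = toℕ ∘ proj₁
  sndℕ = toℕ ∘ proj₂

  -- `concordant` is 1 exactly for pairs inverted both in the row-first and in the column-first
  -- lexicographic order. `discordant` is 1 exactly when the two coordinates compare strictly in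
  -- opposite directions.
  discordant concordant : Cell → Cell → ℕ
  discordant a b = bit ((fstℕ a <ᵇ fstℕ b) ∧ (sndℕ b <ᵇ sndℕ a)) ℕ.+ bit ((fstℕ b <ᵇ fstℕ a) ∧ (sndℕ a <ᵇ sndℕ b))
  concordant a b = bit ((fstℕ b <ᵇ fstℕ a) ∧ not (sndℕ a <ᵇ sndℕ b)) ℕ.+ bit (⌊ proj₁ b ≟F proj₁ a ⌋ ∧ (sndℕ b <ᵇ sndℕ a))

  -- Modulo 2: a pair is inverted in exactly one of the two lexicographic orders iff it is discordant.
  lex-inversion : ∀ a b →
    (bit (fstℕ b <ᵇ fstℕ a) ℕ.+ bit (⌊ proj₁ b ≟F proj₁ a ⌋ ∧ (sndℕ b <ᵇ sndℕ a))) ℕ.+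
    (bit (sndℕ b <ᵇ sndℕ a) ℕ.+ bit (⌊ proj₂ b ≟F proj₂ a ⌋ ∧ (fstℕ b <ᵇ fstℕ a))) ≡
    discordant a b ℕ.+ (concordant a b ℕ.+ concordant a b)
  lex-inversion (a , a′) (b , b′)
    with toℕ b <ᵇ toℕ a | ⌊ b ≟F a ⌋ | toℕ a <ᵇ toℕ b | order a b
       | toℕ b′ <ᵇ toℕ a′ | ⌊ b′ ≟F a′ ⌋ | toℕ a′ <ᵇ toℕ b′ | order a′ b′
  ... | _ | _ | _ | lt | _ | _ | _ | lt = refl
  ... | _ | _ | _ | lt | _ | _ | _ | eq = refl
  ... | _ | _ | _ | lt | _ | _ | _ | gt = refl
  ... | _ | _ | _ | eq | _ | _ | _ | lt = refl
  ... | _ | _ | _ | eq | _ | _ | _ | eq = refl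
  ... | _ | _ | _ | eq | _ | _ | _ | gt = refl
  ... | _ | _ | _ | gt | _ | _ | _ | lt = refl
  ... | _ | _ | _ | gt | _ | _ | _ | eq = refl
  ... | _ | _ | _ | gt | _ | _ | _ | gt = refl

  discordant-sym : ∀ a b → discordant a b ≡ discordant b a
  discordant-sym a b = ℕₚ.+-comm (bit ((fstℕ a <ᵇ fstℕ b) ∧ (sndℕ b <ᵇ sndℕ a))) _

  discordant-irrefl : ∀ a → discordant a a ≡ 0
  discordant-irrefl a rewrite <ᵇ-false (ℕₚ.<-irrefl {fstℕ a} refl) = refl

  grid : List Cell
  grid = concatMap (λ c → map (c ,_) (allFin n)) (allFin k)

  once-grid : ∀ q → countB (λ b → ⌊ q ≟× b ⌋) grid ≡ 1
  once-grid (c , p) = once-product _≟F_ _≟F_ _≟×_ _,_ ×ₚ.,-injective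
    {xs = allFin k} {ys = allFin n} (once-allFin k c) (once-allFin n p)

  -- Doubling replaces pairs in list order by all ordered pairs. That double sum sees only which
  -- cells occur, and in `z` as in `grid` every cell occurs once.
  pairSum-discordant : (z : List Cell) → (∀ q → countB (λ b → ⌊ q ≟× b ⌋) z ≡ 1) →
    pairSum discordant z ≡ pairSum discordant grid
  pairSum-discordant z once = ℕₚ.*-cancelˡ-≡ _ _ 2 (begin
    2 ℕ.* pairSum discordant z
      ≡⟨ sym (pairSum-symmetric discordant discordant-sym discordant-irrefl z) ⟩
    Σℕ.big z (λ a → Σℕ.big z (discordant a))
      ≡⟨ Σℕ.big-cong z (λ a → Σℕ.big-once _≟×_ grid z once-grid once (discordant a)) ⟩
    Σℕ.big z (λ a → Σℕ.big grid (discordant a))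
      ≡⟨ Σℕ.big-once _≟×_ grid z once-grid once _ ⟩
    Σℕ.big grid (λ a → Σℕ.big grid (discordant a))
      ≡⟨ pairSum-symmetric discordant discordant-sym discordant-irrefl grid ⟩
    2 ℕ.* pairSum discordant grid ∎)

  rowWord : List Cell → Fin k → List (Fin n)
  rowWord z c = map proj₂ (List.filterᵇ (λ q → ⌊ proj₁ q ≟F c ⌋) z)

  inversions-exchange : (z : List Cell) →
    (inversions (map fstℕ z) ℕ.+ Σℕ.big (allFin k) (λ c → inversions (finsToℕ (rowWord z c)))) ℕ.+
    (inversions (map sndℕ z) ℕ.+ Σℕ.big (allFin n) (λ p → inversions (finsToℕ (fibre p z)))) ≡
    pairSum discordant z ℕ.+ (pairSum concordant z ℕ.+ pairSum concordant z)
  inversions-exchange z = begin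
    (inversions (map fstℕ z) ℕ.+ Σℕ.big (allFin k) (λ c → inversions (finsToℕ (rowWord z c)))) ℕ.+
    (inversions (map sndℕ z) ℕ.+ Σℕ.big (allFin n) (λ p → inversions (finsToℕ (fibre p z))))
      ≡⟨ cong₂ ℕ._+_
           (cong₂ ℕ._+_ (inversions-pairSum fstℕ z) (≡.trans
             (Σℕ.big-cong (allFin k) (λ c → cong inversions (sym (Listₚ.map-∘ (List.filterᵇ (λ q → ⌊ proj₁ q ≟F c ⌋) z)))))
             (inversions-fibres proj₁ sndℕ z)))
           (cong₂ ℕ._+_ (inversions-pairSum sndℕ z) (≡.trans
             (Σℕ.big-cong (allFin n) (λ p → cong inversions (sym (Listₚ.map-∘ (List.filterᵇ (λ q → ⌊ proj₂ q ≟F p ⌋) z)))))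
             (inversions-fibres proj₂ fstℕ z))) ⟩
    (pairSum (λ a b → bit (fstℕ b <ᵇ fstℕ a)) z ℕ.+ pairSum (λ a b → bit (⌊ proj₁ b ≟F proj₁ a ⌋ ∧ (sndℕ b <ᵇ sndℕ a))) z) ℕ.+
    (pairSum (λ a b → bit (sndℕ b <ᵇ sndℕ a)) z ℕ.+ pairSum (λ a b → bit (⌊ proj₂ b ≟F proj₂ a ⌋ ∧ (fstℕ b <ᵇ fstℕ a))) z)
      ≡⟨ sym (≡.trans (pairSum-+ _ _ z) (cong₂ ℕ._+_ (pairSum-+ _ _ z) (pairSum-+ _ _ z))) ⟩
    pairSum (λ a b →
      (bit (fstℕ b <ᵇ fstℕ a) ℕ.+ bit (⌊ proj₁ b ≟F proj₁ a ⌋ ∧ (sndℕ b <ᵇ sndℕ a))) ℕ.+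
      (bit (sndℕ b <ᵇ sndℕ a) ℕ.+ bit (⌊ proj₂ b ≟F proj₂ a ⌋ ∧ (fstℕ b <ᵇ fstℕ a)))) z
      ≡⟨ pairSum-cong lex-inversion z ⟩
    pairSum (λ a b → discordant a b ℕ.+ (concordant a b ℕ.+ concordant a b)) z
      ≡⟨ ≡.trans (pairSum-+ discordant _ z) (cong (pairSum discordant z ℕ.+_) (pairSum-+ concordant concordant z)) ⟩
    pairSum discordant z ℕ.+ (pairSum concordant z ℕ.+ pairSum concordant z) ∎

σ : ℕ → ℤ
σ m = ℤ.-1ℤ ℤ.^ m

σ-+ : ∀ m n → σ (m ℕ.+ n) ≡ σ m ℤ.* σ n
σ-+ = ℤₚ.^-distribˡ-+-* ℤ.-1ℤ

σ-square : ∀ m → σ m ℤ.* σ m ≡ + 1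
σ-square zero = refl
σ-square (suc m) = ≡.trans (lemma (σ m)) (σ-square m)
  where
  lemma : ∀ u → (ℤ.-1ℤ ℤ.* u) ℤ.* (ℤ.-1ℤ ℤ.* u) ≡ u ℤ.* u
  lemma = ℤSolver.solve-∀

-- The hypothesis says that p + q and e have the same parity; multiplying by σ q, which is its own
-- inverse, isolates σ p.
σ-parity : ∀ p q {e r} → p ℕ.+ q ≡ e ℕ.+ (r ℕ.+ r) → σ p ≡ σ q ℤ.* σ e
σ-parity p q {e} {r} h = begin
  σ p                          ≡⟨ sym (ℤₚ.*-identityʳ (σ p)) ⟩
  σ p ℤ.* + 1                  ≡⟨ cong (σ p ℤ.*_) (sym (σ-square q)) ⟩
  σ p ℤ.* (σ q ℤ.* σ q)        ≡⟨ sym (ℤₚ.*-assoc (σ p) (σ q) (σ q)) ⟩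
  σ p ℤ.* σ q ℤ.* σ q          ≡⟨ cong (ℤ._* σ q) (sym (σ-+ p q)) ⟩
  σ (p ℕ.+ q) ℤ.* σ q          ≡⟨ cong (λ m → σ m ℤ.* σ q) h ⟩
  σ (e ℕ.+ (r ℕ.+ r)) ℤ.* σ q  ≡⟨ cong (ℤ._* σ q) (≡.trans (σ-+ e (r ℕ.+ r)) (cong (σ e ℤ.*_) (≡.trans (σ-+ r r) (σ-square r)))) ⟩
  σ e ℤ.* + 1 ℤ.* σ q          ≡⟨ cong (ℤ._* σ q) (ℤₚ.*-identityʳ (σ e)) ⟩
  σ e ℤ.* σ q                  ≡⟨ ℤₚ.*-comm (σ e) (σ q) ⟩
  σ q ℤ.* σ e                  ∎

Π-signW : (xs : List A) (w : A → List ℕ) → Πℤ.big xs (signW ∘ w) ≡ σ (Σℕ.big xs (inversions ∘ w))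
Π-signW xs w = sym (Σℕ.big-hom σ refl σ-+ xs (inversions ∘ w))

count-map-filterᵇ : (p : B → Bool) (h : A → B) (q : A → Bool) (z : List A) →
  countB p (map h (List.filterᵇ q z)) ≡ countB (λ a → q a ∧ p (h a)) z
count-map-filterᵇ p h q z = ≡.trans (count-map p h (List.filterᵇ q z)) (count-filterᵇ (p ∘ h) q z)

module _ {k n : ℕ} where

  -- Both conditions say that every cell (c , p) occurs exactly once in `z`.
  isPermFin-exchange : (z : List (Fin k × Fin n)) →
    allB (isPermFin ∘ rowWord z) (allFin k) ≡ allB (λ p → isPermFin (fibre p z)) (allFin n)
  isPermFin-exchange z = begin
    allB (isPermFin ∘ rowWord z) (allFin k)
      ≡⟨ ≡.trans (allB-cong (allFin k) (λ c → allB-cong (allFin n) (λ p → cong (_≡ᵇ 1) (counts c p)))) (nested (allFin k) (allFin n) _) ⟩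
    ⋀.big (allFin k) (λ c → ⋀.big (allFin n) (λ p → countB (λ b → ⌊ c ≟F b ⌋) (fibre p z) ≡ᵇ 1))
      ≡⟨ ⋀.big-swap (allFin k) (allFin n) _ ⟩
    ⋀.big (allFin n) (λ p → ⋀.big (allFin k) (λ c → countB (λ b → ⌊ c ≟F b ⌋) (fibre p z) ≡ᵇ 1))
      ≡⟨ sym (nested (allFin n) (allFin k) _) ⟩
    allB (λ p → isPermFin (fibre p z)) (allFin n) ∎
    where
    nested : (xs : List A) (ys : List B) (b : A → B → Bool) →
      allB (λ x → allB (b x) ys) xs ≡ ⋀.big xs (λ x → ⋀.big ys (b x))
    nested xs ys b = ≡.trans (allB-big _ xs) (⋀.big-cong xs (λ x → allB-big (b x) ys))
    counts : ∀ c p → countB (λ b → ⌊ p ≟F b ⌋) (rowWord z c) ≡ countB (λ b → ⌊ c ≟F b ⌋) (fibre p z)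
    counts c p = begin
      countB (λ b → ⌊ p ≟F b ⌋) (rowWord z c)
        ≡⟨ count-map-filterᵇ (λ b → ⌊ p ≟F b ⌋) proj₂ (λ q → ⌊ proj₁ q ≟F c ⌋) z ⟩
      countB (λ q → ⌊ proj₁ q ≟F c ⌋ ∧ ⌊ p ≟F proj₂ q ⌋) z
        ≡⟨ count-cong z (λ q → ≡.trans (Boolₚ.∧-comm ⌊ proj₁ q ≟F c ⌋ _)
             (cong₂ _∧_ (⌊⌋-sym _≟F_ p (proj₂ q)) (⌊⌋-sym _≟F_ (proj₁ q) c))) ⟩
      countB (λ q → ⌊ proj₂ q ≟F p ⌋ ∧ ⌊ c ≟F proj₁ q ⌋) z
        ≡⟨ sym (count-map-filterᵇ (λ b → ⌊ c ≟F b ⌋) proj₁ (λ q → ⌊ proj₂ q ≟F p ⌋) z) ⟩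
      countB (λ b → ⌊ c ≟F b ⌋) (fibre p z) ∎

  isPermFin-once-cell : (z : List (Fin k × Fin n)) → allB (λ p → isPermFin (fibre p z)) (allFin n) ≡ true →
    ∀ q → countB (λ b → ⌊ q ≟× b ⌋) z ≡ 1
  isPermFin-once-cell z e (c , p) = begin
    countB (λ b → ⌊ (c , p) ≟× b ⌋) z
      ≡⟨ count-cong z cell ⟩
    countB (λ q → ⌊ proj₂ q ≟F p ⌋ ∧ ⌊ c ≟F proj₁ q ⌋) z
      ≡⟨ sym (count-map-filterᵇ (λ b → ⌊ c ≟F b ⌋) proj₁ (λ q → ⌊ proj₂ q ≟F p ⌋) z) ⟩
    countB (λ b → ⌊ c ≟F b ⌋) (fibre p z)
      ≡⟨ isPermFin-once (fibre p z) (allB-true⁻ _ (allFin n) e (∈-allFin p)) c ⟩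
    1 ∎
    where
    cell : ∀ q → ⌊ (c , p) ≟× q ⌋ ≡ ⌊ proj₂ q ≟F p ⌋ ∧ ⌊ c ≟F proj₁ q ⌋
    cell (c′ , p′) with p′ ≟F p | c ≟F c′ | (c , p) ≟× (c′ , p′)
    ... | yes _ | yes _ | yes _ = refl
    ... | yes refl | yes refl | no ≢ = contradiction refl ≢
    ... | no p≢ | _ | yes refl = contradiction refl p≢
    ... | yes _ | no c≢ | yes refl = contradiction refl c≢
    ... | no _ | _ | no _ = refl
    ... | yes _ | no _ | no _ = refl

  -- The sign ε of the overview. The grid has one discordant pair for each choice of two rows and
  -- two columns, so the exponent is k(k-1)/2 times n(n-1)/2.
  gridSign : ℤ
  gridSign = σ (pairSum (discordant {k} {n}) grid)

  -- Sorting the cells of a k×n grid lexicographically by rows or by columns: the two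
  -- permutations differ by the transposition of the grid, whose sign depends on k and n only.
  sgnFin-exchange : (z : List (Fin k × Fin n)) →
    signW (finsToℕ (map proj₁ z)) ℤ.* Πℤ.big (allFin k) (λ c → sgnFin (rowWord z c)) ≡
    signW (finsToℕ (map proj₂ z)) ℤ.* gridSign ℤ.* Πℤ.big (allFin n) (λ p → sgnFin (fibre p z))
  sgnFin-exchange z = begin
    signW (finsToℕ (map proj₁ z)) ℤ.* Πℤ.big (allFin k) (λ c → sgnFin (rowWord z c))
      ≡⟨ cong₂ ℤ._*_ (cong signW (sym (Listₚ.map-∘ z)))
           (≡.trans (Π-if (allFin k) (isPermFin ∘ rowWord z) _) (cong₂ (if_then_else + 0) (isPermFin-exchange z) (Π-signW (allFin k) (finsToℕ ∘ rowWord z)))) ⟩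
    σ (inversions (map fstℕ z)) ℤ.* (if b then σ rows else + 0)
      ≡⟨ compare b refl ⟩
    σ (inversions (map sndℕ z)) ℤ.* gridSign ℤ.* (if b then σ cols else + 0)
      ≡⟨ sym (cong₂ (λ w t → w ℤ.* gridSign ℤ.* t) (cong signW (sym (Listₚ.map-∘ z)))
           (≡.trans (Π-if (allFin n) (λ p → isPermFin (fibre p z)) _) (cong (if b then_else + 0) (Π-signW (allFin n) (λ p → finsToℕ (fibre p z)))))) ⟩
    signW (finsToℕ (map proj₂ z)) ℤ.* gridSign ℤ.* Πℤ.big (allFin n) (λ p → sgnFin (fibre p z)) ∎
    where
    b = allB (λ p → isPermFin (fibre p z)) (allFin n)
    rows = Σℕ.big (allFin k) (λ c → inversions (finsToℕ (rowWord z c)))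
    cols = Σℕ.big (allFin n) (λ p → inversions (finsToℕ (fibre p z)))
    compare : ∀ b′ → b′ ≡ b → σ (inversions (map fstℕ z)) ℤ.* (if b′ then σ rows else + 0) ≡
      σ (inversions (map sndℕ z)) ℤ.* gridSign ℤ.* (if b′ then σ cols else + 0)
    compare false _ = ≡.trans (ℤₚ.*-zeroʳ (σ (inversions (map fstℕ z)))) (sym (ℤₚ.*-zeroʳ (σ (inversions (map sndℕ z)) ℤ.* gridSign)))
    compare true e = begin
      σ (inversions (map fstℕ z)) ℤ.* σ rows
        ≡⟨ sym (σ-+ (inversions (map fstℕ z)) rows) ⟩
      σ (inversions (map fstℕ z) ℕ.+ rows)
        -- Concordant pairs are counted twice and drop out of the parity.
        ≡⟨ σ-parity (inversions (map fstℕ z) ℕ.+ rows) (inversions (map sndℕ z) ℕ.+ cols) {pairSum discordant z} {r = pairSum concordant z} (inversions-exchange z) ⟩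
      σ (inversions (map sndℕ z) ℕ.+ cols) ℤ.* σ (pairSum discordant z)
        -- The nonvanishing of the signs puts each cell once into `z`; this makes the discordant
        -- count independent of `z`.
        ≡⟨ cong₂ ℤ._*_ (σ-+ (inversions (map sndℕ z)) cols) (cong σ (pairSum-discordant z (isPermFin-once-cell z (sym e)))) ⟩
      σ (inversions (map sndℕ z)) ℤ.* σ cols ℤ.* gridSign
        ≡⟨ lemma (σ (inversions (map sndℕ z))) (σ cols) gridSign ⟩
      σ (inversions (map sndℕ z)) ℤ.* gridSign ℤ.* σ cols ∎
      where
      lemma : ∀ a c g → a ℤ.* c ℤ.* g ≡ a ℤ.* g ℤ.* c
      lemma = ℤSolver.solve-∀

-- Signs of tables with prescribed row content

Balanced : {k d : ℕ} → ℕ → Table k d → Set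
Balanced {k} {d} n S = ∀ (i : Fin d) (c : Fin k) → countB (λ x → ⌊ x ≟F c ⌋) (row S i) ≡ n

zip-proj₁ : (xs : List A) (ys : List B) → length ys ≡ length xs → map proj₁ (zip xs ys) ≡ xs
zip-proj₁ [] [] e = refl
zip-proj₁ (x ∷ xs) (y ∷ ys) e = cong (x ∷_) (zip-proj₁ xs ys (ℕₚ.suc-injective e))

zip-proj₂ : (xs : List A) (ys : List B) → length ys ≡ length xs → map proj₂ (zip xs ys) ≡ ys
zip-proj₂ [] [] e = refl
zip-proj₂ (x ∷ xs) (y ∷ ys) e = cong (y ∷_) (zip-proj₂ xs ys (ℕₚ.suc-injective e))

zip-mapˡ : {E : Set} (h : A → E) (xs : List A) (ys : List B) → zip (map h xs) ys ≡ map (map₁ h) (zip xs ys)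
zip-mapˡ h [] ys = refl
zip-mapˡ h (x ∷ xs) [] = refl
zip-mapˡ h (x ∷ xs) (y ∷ ys) = cong (_ ∷_) (zip-mapˡ h xs ys)

fibre-map₁ : {n : ℕ} (h : A → B) (p : Fin n) (z : List (A × Fin n)) → fibre p (map (map₁ h) z) ≡ map h (fibre p z)
fibre-map₁ h p [] = refl
fibre-map₁ h p ((a , q) ∷ z) with q ≟F p
... | yes _ = cong (h a ∷_) (fibre-map₁ h p z)
... | no _ = fibre-map₁ h p z

module _ {k n d : ℕ} (S : Table k d) (balanced : Balanced n S) (x : List (Fin n)) (len : length x ≡ length S) where

  -- Row `i` and the labels `x` together form a list of cells. Reading it by letters gives the
  -- subwords in `sgnWord`, reading it by labels gives row `i` of the fibres.
  sgnWord-exchange : (i : Fin d) → signW (finsToℕ (row S i)) ℤ.* sgnWord (row S i) x ≡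
    signW (finsToℕ x) ℤ.* gridSign {k} {n} ℤ.* Πℤ.big (allFin n) (λ p → sgnFin (row (fibre p (zip S x)) i))
  sgnWord-exchange i = begin
    signW (finsToℕ (row S i)) ℤ.* sgnWord (row S i) x
      ≡⟨ cong₂ ℤ._*_ (cong (signW ∘ finsToℕ) (sym (zip-proj₁ (row S i) x len′))) (Πℤ.big-cong (allFin k) letter) ⟩
    signW (finsToℕ (map proj₁ z)) ℤ.* Πℤ.big (allFin k) (λ c → sgnFin (rowWord z c))
      ≡⟨ sgnFin-exchange z ⟩
    signW (finsToℕ (map proj₂ z)) ℤ.* gridSign {k} {n} ℤ.* Πℤ.big (allFin n) (λ p → sgnFin (fibre p z))
      ≡⟨ cong₂ (λ w t → signW (finsToℕ w) ℤ.* gridSign {k} {n} ℤ.* t) (zip-proj₂ (row S i) x len′)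
           (Πℤ.big-cong (allFin n) (λ p → cong sgnFin (≡.trans (cong (fibre p) (zip-mapˡ _ S x)) (fibre-map₁ _ p (zip S x))))) ⟩
    signW (finsToℕ x) ℤ.* gridSign {k} {n} ℤ.* Πℤ.big (allFin n) (λ p → sgnFin (row (fibre p (zip S x)) i)) ∎
    where
    z = zip (row S i) x
    len′ : length x ≡ length (row S i)
    len′ = ≡.trans len (sym (Listₚ.length-map _ S))
    -- Balance makes the subword of each letter have length `n`, where `psgn` and `sgnFin` agree.
    letter : ∀ c → psgn (map (λ p → toℕ (proj₂ p)) (List.filterᵇ (λ p → ⌊ proj₁ p ≟F c ⌋) z)) ≡ sgnFin (rowWord z c)
    letter c = ≡.trans (cong psgn (Listₚ.map-∘ (List.filterᵇ (λ p → ⌊ proj₁ p ≟F c ⌋) z)))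
      (psgn-finsToℕ (rowWord z c) (begin
        length (rowWord z c)                                       ≡⟨ Listₚ.length-map proj₂ (List.filterᵇ (λ q → ⌊ proj₁ q ≟F c ⌋) z) ⟩
        countB (λ q → ⌊ proj₁ q ≟F c ⌋) z                          ≡⟨ sym (count-map _ proj₁ z) ⟩
        countB (λ b → ⌊ b ≟F c ⌋) (map proj₁ z)                    ≡⟨ cong (countB (λ b → ⌊ b ≟F c ⌋)) (zip-proj₁ (row S i) x len′) ⟩
        countB (λ b → ⌊ b ≟F c ⌋) (row S i)                        ≡⟨ balanced i c ⟩
        n ∎))

  -- The factor relating the two readings depends on `x` but not on the row, so an even number of
  -- rows removes it. Exchanging the products over rows and labels then produces `sgnRows` of each
  -- fibre.
  sgnTable-exchange : 2 ∣ d →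
    Πℤ.big (allFin d) (λ i → signW (finsToℕ (row S i)) ℤ.* sgnWord (row S i) x) ≡
    Πℤ.big (allFin n) (λ p → sgnRows (fibre p (zip S x)))
  sgnTable-exchange even = begin
    Πℤ.big (allFin d) (λ i → signW (finsToℕ (row S i)) ℤ.* sgnWord (row S i) x)
      ≡⟨ Πℤ.big-cong (allFin d) sgnWord-exchange ⟩
    Πℤ.big (allFin d) (λ i → u ℤ.* Πℤ.big (allFin n) (λ p → sgnFin (row (fibre p (zip S x)) i)))
      ≡⟨ Π-scale-even even u uu _ ⟩
    Πℤ.big (allFin d) (λ i → Πℤ.big (allFin n) (λ p → sgnFin (row (fibre p (zip S x)) i)))
      ≡⟨ Πℤ.big-swap (allFin d) (allFin n) _ ⟩
    Πℤ.big (allFin n) (λ p → sgnRows (fibre p (zip S x))) ∎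
    where
    u = signW (finsToℕ x) ℤ.* gridSign {k} {n}
    uu : u ℤ.* u ≡ + 1
    uu = ≡.trans (lemma (signW (finsToℕ x)) (gridSign {k} {n}))
      (cong₂ ℤ._*_ (σ-square (inversions (finsToℕ x))) (σ-square (pairSum (discordant {k} {n}) grid)))
      where
      lemma : ∀ a g → (a ℤ.* g) ℤ.* (a ℤ.* g) ≡ (a ℤ.* a) ℤ.* (g ℤ.* g)
      lemma = ℤSolver.solve-∀

-- Evaluation at the unit tensor

if-∧ : {X : Set} (a b : Bool) (x y : X) → (if a ∧ b then x else y) ≡ (if a then (if b then x else y) else y)
if-∧ true b x y = refl
if-∧ false b x y = refl

big-constant : (_≟_ : DecidableEquality A) (xs : List A) (a : A) → countB (λ b → ⌊ a ≟ b ⌋) xs ≡ 1 →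
  (n : ℕ) (g : Vec A n → ℚ) →
  Σℚ.big (allVecs xs n) (λ v → if allB (λ b → ⌊ a ≟ b ⌋) (Vec.toList v) then g v else 0ℚ) ≡ g (Vec.replicate n a)
big-constant _≟_ xs a once zero g = ℚₚ.+-identityʳ _
big-constant _≟_ xs a once (suc n) g = begin
  Σℚ.big (allVecs xs (suc n)) (λ v → if allB (λ b → ⌊ a ≟ b ⌋) (Vec.toList v) then g v else 0ℚ)
    ≡⟨ Σℚ.big-allVecs-suc xs n _ ⟩
  Σℚ.big xs (λ b → Σℚ.big (allVecs xs n) (λ v → if ⌊ a ≟ b ⌋ ∧ allB (λ b → ⌊ a ≟ b ⌋) (Vec.toList v) then g (b ∷ v) else 0ℚ))
    ≡⟨ Σℚ.big-cong xs (λ b → ≡.trans (Σℚ.big-cong (allVecs xs n) (λ v → if-∧ ⌊ a ≟ b ⌋ _ _ _))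
         (≡.trans (Σℚ.big-if (allVecs xs n) ⌊ a ≟ b ⌋ _)
           (cong (if ⌊ a ≟ b ⌋ then_else 0ℚ) (big-constant _≟_ xs a once n (λ v → g (b ∷ v)))))) ⟩
  Σℚ.big xs (λ b → if ⌊ a ≟ b ⌋ then g (b ∷ Vec.replicate n a) else 0ℚ)
    ≡⟨ Σℚ.big-single _≟_ a xs (λ b → g (b ∷ Vec.replicate n a)) once ⟩
  g (Vec.replicate (suc n) a) ∎

big-isDiag : (N d : ℕ) (g : Col N (suc d) → ℚ) →
  Σℚ.big (allCols N (suc d)) (λ v → if isDiag v then g v else 0ℚ) ≡
  Σℚ.big (allFin N) (λ a → g (Vec.replicate (suc d) a))
big-isDiag N d g = ≡.trans (Σℚ.big-allVecs-suc (allFin N) d _)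
  (Σℚ.big-cong (allFin N) (λ a → big-constant _≟F_ (allFin N) a (once-allFin N a) d (λ v → g (a ∷ v))))

-- A column on the diagonal is determined by its first entry, so a table with nonzero value is one
-- word repeated in all rows.
big-diagonal : (N d m : ℕ) (f : Table N (suc d) → ℚ) →
  Σℚ.big (allLists (allCols N (suc d)) m) (λ X → f X ℚ.* prodℚ (map (λ v → if isDiag v then 1ℚ else 0ℚ) X)) ≡
  Σℚ.big (allLists (allFin N) m) (λ x → f (map (Vec.replicate (suc d)) x))
big-diagonal N d zero f = cong (ℚ._+ 0ℚ) (ℚₚ.*-identityʳ (f []))
big-diagonal N d (suc m) f = begin
  Σℚ.big (allLists (allCols N (suc d)) (suc m)) (λ X → f X ℚ.* prodℚ (map diag X))
    ≡⟨ Σℚ.big-allLists-suc (allCols N (suc d)) m _ ⟩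
  Σℚ.big (allCols N (suc d)) (λ v → Σℚ.big tables (λ X → f (v ∷ X) ℚ.* (diag v ℚ.* prodℚ (map diag X))))
    ≡⟨ Σℚ.big-cong (allCols N (suc d)) (λ v → ≡.trans (Σℚ.big-cong tables (pull v)) (Σℚ.big-if tables (isDiag v) _)) ⟩
  Σℚ.big (allCols N (suc d)) (λ v → if isDiag v then Σℚ.big tables (λ X → f (v ∷ X) ℚ.* prodℚ (map diag X)) else 0ℚ)
    ≡⟨ big-isDiag N d _ ⟩
  Σℚ.big (allFin N) (λ a → Σℚ.big tables (λ X → f (Vec.replicate (suc d) a ∷ X) ℚ.* prodℚ (map diag X)))
    ≡⟨ Σℚ.big-cong (allFin N) (λ a → big-diagonal N d m (λ X → f (Vec.replicate (suc d) a ∷ X))) ⟩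
  Σℚ.big (allFin N) (λ a → Σℚ.big (allLists (allFin N) m) (λ x → f (map (Vec.replicate (suc d)) (a ∷ x))))
    ≡⟨ sym (Σℚ.big-allLists-suc (allFin N) m _) ⟩
  Σℚ.big (allLists (allFin N) (suc m)) (λ x → f (map (Vec.replicate (suc d)) x)) ∎
  where
  diag : Col N (suc d) → ℚ
  diag v = if isDiag v then 1ℚ else 0ℚ
  tables = allLists (allCols N (suc d)) m
  pull : ∀ v X → f (v ∷ X) ℚ.* (diag v ℚ.* prodℚ (map diag X)) ≡ (if isDiag v then f (v ∷ X) ℚ.* prodℚ (map diag X) else 0ℚ)
  pull v X with isDiag v
  ... | true = cong (f (v ∷ X) ℚ.*_) (ℚₚ.*-identityˡ (prodℚ (map diag X)))
  ... | false = ≡.trans (cong (f (v ∷ X) ℚ.*_) (ℚₚ.*-zeroˡ (prodℚ (map diag X)))) (ℚₚ.*-zeroʳ (f (v ∷ X)))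

evalUnit-Delta : {k d : ℕ} (n : ℕ) (S : Table k (suc d)) →
  evalUnit (Delta n S) ≡
  Σℚ.big (allLists (allFin n) (length S))
    (λ x → ℤtoℚ (signT S ℤ.* Πℤ.big (allFin (suc d)) (λ i → sgnWord (row S i) x))) ℚ.* recipℕ (normT S)
evalUnit-Delta {k} {d} n S = begin
  evalUnit (Delta n S)
    ≡⟨ Σℚ.big-map _ (allLists (allCols n (suc d)) (length S)) _ ⟩
  Σℚ.big (allLists (allCols n (suc d)) (length S)) (λ X →
    ℤtoℚ (signT S ℤ.* sgnTable S X) ℚ.* recipℕ (normT S) ℚ.* prodℚ (map (λ v → if isDiag v then 1ℚ else 0ℚ) X))
    ≡⟨ big-diagonal n d (length S) (λ X → ℤtoℚ (signT S ℤ.* sgnTable S X) ℚ.* recipℕ (normT S)) ⟩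
  Σℚ.big (allLists (allFin n) (length S)) (λ x →
    ℤtoℚ (signT S ℤ.* sgnTable S (map (Vec.replicate (suc d)) x)) ℚ.* recipℕ (normT S))
    ≡⟨ Σℚ.big-cong (allLists (allFin n) (length S)) (λ x → cong (λ t → ℤtoℚ (signT S ℤ.* t) ℚ.* recipℕ (normT S))
         (Πℤ.big-cong (allFin (suc d)) (λ i → cong (sgnWord (row S i)) (row-replicate x i)))) ⟩
  Σℚ.big (allLists (allFin n) (length S)) (λ x →
    ℤtoℚ (signT S ℤ.* Πℤ.big (allFin (suc d)) (λ i → sgnWord (row S i) x)) ℚ.* recipℕ (normT S))
    ≡⟨ sym (big-* (allLists (allFin n) (length S)) _ (recipℕ (normT S))) ⟩
  _ ∎
  where
  row-replicate : ∀ x i → row (map (Vec.replicate (suc d)) x) i ≡ x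
  row-replicate x i = ≡.trans (sym (Listₚ.map-∘ x))
    (≡.trans (Listₚ.map-cong (λ a → Vecₚ.lookup-replicate i a) x) (Listₚ.map-id x))

big-cong-length : (xs : List A) (m : ℕ) {f g : List A → ℚ} → (∀ x → length x ≡ m → f x ≡ g x) →
  Σℚ.big (allLists xs m) f ≡ Σℚ.big (allLists xs m) g
big-cong-length xs m {f} {g} e = ≡.trans (Σℚ.big-allLists xs m f) (≡.trans
  (Σℚ.big-cong (allVecs xs m) (λ v → e (Vec.toList v) (Vecₚ.length-toList v))) (sym (Σℚ.big-allLists xs m g)))

coeff-hyperdet^ : {k d : ℕ} → 2 ∣ suc d → (n : ℕ) (M : Monomial k (suc d)) →
  coeff (hyperdet (suc d) k ^P n) M ≡
  Σℚ.big (allLists (allFin n) (length M)) (λ x → ℤtoℚ (Πℤ.big (allFin n) (λ p → sgnRows (fibre p (zip M x)))))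
    ℚ.* recipℕ (normT M)
coeff-hyperdet^ {k} {d} even n M = ≡.trans (coeff-deriv (hyperdet (suc d) k ^P n) M)
  (cong (ℚ._* recipℕ (normT M)) (≡.trans (deriv-hyperdet^ even n M)
    (Σℚ.big-cong (allLists (allFin n) (length M)) (λ x → sym (Πℤ.big-hom ℤtoℚ refl ℤtoℚ-* (allFin n) _)))))

-- Both sides carry the same 1/‖S‖, and the remaining sums over words agree term by term. Sortedness
-- is not assumed, so the table of all cells can be inserted directly.
coeff-balanced : {k d : ℕ} → 2 ∣ suc d → (n : ℕ) (S : Table k (suc d)) → Balanced n S →
  coeff (hyperdet (suc d) k ^P n) S ≡ evalUnit (Delta n S)
coeff-balanced {k} {d} even n S balanced = ≡.trans (coeff-hyperdet^ even n S) (≡.trans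
  (cong (ℚ._* recipℕ (normT S)) (big-cong-length (allFin n) (length S) (λ x len → cong ℤtoℚ (≡.trans
    (sym (sgnTable-exchange S balanced x len even)) (Πℤ.big-∙ (allFin (suc d)) (λ i → signW (finsToℕ (row S i))) (λ i → sgnWord (row S i) x))))))
  (sym (evalUnit-Delta n S)))

-- Monomials that do not occur in the power

big-const : (xs : List A) (m : ℕ) → Σℕ.big xs (λ _ → m) ≡ length xs ℕ.* m
big-const [] m = refl
big-const (x ∷ xs) m = cong (m ℕ.+_) (big-const xs m)

big-fibre : {n : ℕ} (M : List A) (x : List (Fin n)) → length x ≡ length M → (f : A → ℕ) →
  Σℕ.big M f ≡ Σℕ.big (allFin n) (λ p → Σℕ.big (fibre p (zip M x)) f)
big-fibre {n = n} M x len f = begin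
  Σℕ.big M f
    ≡⟨ cong (λ M → Σℕ.big M f) (sym (zip-proj₁ M x len)) ⟩
  Σℕ.big (map proj₁ (zip M x)) f
    ≡⟨ Σℕ.big-map proj₁ (zip M x) f ⟩
  Σℕ.big (zip M x) (f ∘ proj₁)
    ≡⟨ Σℕ.big-fibres _≟F_ (allFin n) (once-allFin n) proj₂ (zip M x) (f ∘ proj₁) ⟩
  Σℕ.big (allFin n) (λ p → Σℕ.big (zip M x) (λ q → if ⌊ proj₂ q ≟F p ⌋ then f (proj₁ q) else 0))
    ≡⟨ Σℕ.big-cong (allFin n) (λ p → sym (≡.trans
         (Σℕ.big-map proj₁ (List.filterᵇ (λ q → ⌊ proj₂ q ≟F p ⌋) (zip M x)) f) (Σℕ.big-filterᵇ _ (zip M x) _))) ⟩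
  Σℕ.big (allFin n) (λ p → Σℕ.big (fibre p (zip M x)) f) ∎

-- Membership in `Alex` up to the order of the columns.
Full : {k d : ℕ} → ℕ → Monomial k d → Set
Full {k} n M = length M ≡ k ℕ.* n × Balanced n M

Full-↭ : {k d n : ℕ} {M M′ : Monomial k d} → M ↭ M′ → Full n M → Full n M′
Full-↭ M↭M′ (len , balanced) =
  ≡.trans (sym (↭-length M↭M′)) len ,
  λ i c → ≡.trans (sym (count-↭ _ (map⁺ (λ v → lookup v i) M↭M′))) (balanced i c)

-- Each of the `n` fibres contributes `k` columns, and to every row each letter once.
Full-fibres : {k d n : ℕ} (M : Monomial k (suc d)) (x : List (Fin n)) → length x ≡ length M →
  allB (λ p → allB (λ i → isPermFin (row (fibre p (zip M x)) i)) (allFin (suc d))) (allFin n) ≡ true → Full n M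
Full-fibres {k} {d} {n} M x len e = total , balanced
  where
  rows : ∀ p i → isPermFin (row (fibre p (zip M x)) i) ≡ true
  rows p i = allB-true⁻ _ (allFin (suc d)) (allB-true⁻ _ (allFin n) e (∈-allFin p)) (∈-allFin i)
  constant : ∀ m → Σℕ.big (allFin n) (λ _ → m) ≡ n ℕ.* m
  constant m = ≡.trans (big-const (allFin n) m) (cong (ℕ._* m) (Listₚ.length-tabulate {n = n} (λ i → i)))
  total : length M ≡ k ℕ.* n
  total = begin
    length M
      ≡⟨ ≡.trans (length-big M) (big-fibre M x len _) ⟩
    Σℕ.big (allFin n) (λ p → Σℕ.big (fibre p (zip M x)) (λ _ → 1))
      ≡⟨ Σℕ.big-cong (allFin n) (λ p → ≡.trans (sym (length-big (fibre p (zip M x))))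
           (≡.trans (sym (Listₚ.length-map (λ v → lookup v zero) (fibre p (zip M x)))) (length-isPermFin (row (fibre p (zip M x)) zero) (rows p zero)))) ⟩
    Σℕ.big (allFin n) (λ _ → k)
      ≡⟨ ≡.trans (constant k) (ℕₚ.*-comm n k) ⟩
    k ℕ.* n ∎
  balanced : Balanced n M
  balanced i c = begin
    countB (λ b → ⌊ b ≟F c ⌋) (row M i)
      ≡⟨ ≡.trans (count-map _ _ M) (≡.trans (count-big _ M) (big-fibre M x len _)) ⟩
    Σℕ.big (allFin n) (λ p → Σℕ.big (fibre p (zip M x)) (λ v → bit ⌊ lookup v i ≟F c ⌋))
      ≡⟨ Σℕ.big-cong (allFin n) (λ p → begin
           Σℕ.big (fibre p (zip M x)) (λ v → bit ⌊ lookup v i ≟F c ⌋)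
             ≡⟨ sym (≡.trans (count-map (λ b → ⌊ b ≟F c ⌋) (λ v → lookup v i) (fibre p (zip M x))) (count-big _ (fibre p (zip M x)))) ⟩
           countB (λ b → ⌊ b ≟F c ⌋) (row (fibre p (zip M x)) i)
             ≡⟨ count-cong (row (fibre p (zip M x)) i) (λ b → ⌊⌋-sym _≟F_ b c) ⟩
           countB (λ b → ⌊ c ≟F b ⌋) (row (fibre p (zip M x)) i)
             ≡⟨ isPermFin-once (row (fibre p (zip M x)) i) (rows p i) c ⟩
           1 ∎) ⟩
    Σℕ.big (allFin n) (λ _ → 1)
      ≡⟨ ≡.trans (constant 1) (ℕₚ.*-identityʳ n) ⟩
    n ∎

coeff-¬Full : {k d : ℕ} → 2 ∣ suc d → (n : ℕ) (M : Monomial k (suc d)) → ¬ Full n M →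
  coeff (hyperdet (suc d) k ^P n) M ≡ 0ℚ
coeff-¬Full {k} {d} even n M ¬full = begin
  coeff (hyperdet (suc d) k ^P n) M
    ≡⟨ coeff-hyperdet^ even n M ⟩
  Σℚ.big (allLists (allFin n) (length M)) (λ x → ℤtoℚ (Πℤ.big (allFin n) (λ p → sgnRows (fibre p (zip M x))))) ℚ.* recipℕ (normT M)
    ≡⟨ cong (ℚ._* recipℕ (normT M)) (≡.trans (big-cong-length (allFin n) (length M) vanish) (Σℚ.big-ε (allLists (allFin n) (length M)))) ⟩
  0ℚ ℚ.* recipℕ (normT M)
    ≡⟨ ℚₚ.*-zeroˡ (recipℕ (normT M)) ⟩
  0ℚ ∎
  where
  vanish : ∀ x → length x ≡ length M → ℤtoℚ (Πℤ.big (allFin n) (λ p → sgnRows (fibre p (zip M x)))) ≡ 0ℚ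
  vanish x len = cong ℤtoℚ (≡.trans
    (Πℤ.big-cong (allFin n) (λ p → Π-if (allFin (suc d)) (λ i → isPermFin (row (fibre p (zip M x)) i)) _))
    (≡.trans (Π-if (allFin n) (λ p → allB (λ i → isPermFin (row (fibre p (zip M x)) i)) (allFin (suc d))) _) zero-case))
    where
    zero-case : ∀ {t} → (if allB (λ p → allB (λ i → isPermFin (row (fibre p (zip M x)) i)) (allFin (suc d))) (allFin n) then t else + 0) ≡ + 0
    zero-case with allB (λ p → allB (λ i → isPermFin (row (fibre p (zip M x)) i)) (allFin (suc d))) (allFin n) in e
    ... | false = refl
    ... | true = contradiction (Full-fibres M x len e) ¬full

-- Lexicographically sorted representatives

module _ {N : ℕ} where

  infix 4 _≤ₗ_
  _≤ₗ_ : {d : ℕ} → Col N d → Col N d → Set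
  v ≤ₗ w = lexLeq v w ≡ true

  ≤ₗ-∷⁻ : {d : ℕ} (a b : Fin N) (v w : Col N d) → a ∷ v ≤ₗ b ∷ w → toℕ a ℕ.< toℕ b ⊎ (a ≡ b × v ≤ₗ w)
  ≤ₗ-∷⁻ a b v w e with toℕ a <ᵇ toℕ b in a<b | toℕ a ≡ᵇ toℕ b in a≡b
  ... | true | _ = inj₁ (ℕₚ.<ᵇ⇒< (toℕ a) (toℕ b) (Equivalence.from Boolₚ.T-≡ a<b))
  ... | false | true = inj₂ (toℕ-injective (≡ᵇ-true⁻ a≡b) , e)

  ≤ₗ-< : {d : ℕ} (a b : Fin N) (v w : Col N d) → toℕ a ℕ.< toℕ b → a ∷ v ≤ₗ b ∷ w
  ≤ₗ-< a b v w a<b rewrite <ᵇ-true a<b = refl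

  ≤ₗ-≡ : {d : ℕ} (a : Fin N) (v w : Col N d) → v ≤ₗ w → a ∷ v ≤ₗ a ∷ w
  ≤ₗ-≡ a v w v≤w rewrite ≡ᵇ-true⁺ {toℕ a} refl | v≤w = Boolₚ.∨-zeroʳ (toℕ a <ᵇ toℕ a)

  ≤ₗ-refl : {d : ℕ} (v : Col N d) → v ≤ₗ v
  ≤ₗ-refl [] = refl
  ≤ₗ-refl (a ∷ v) = ≤ₗ-≡ a v v (≤ₗ-refl v)

  ≤ₗ-trans : {d : ℕ} (u v w : Col N d) → u ≤ₗ v → v ≤ₗ w → u ≤ₗ w
  ≤ₗ-trans [] [] [] _ _ = refl
  ≤ₗ-trans (a ∷ u) (b ∷ v) (c ∷ w) u≤v v≤w with ≤ₗ-∷⁻ a b u v u≤v | ≤ₗ-∷⁻ b c v w v≤w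
  ... | inj₁ a<b | inj₁ b<c = ≤ₗ-< a c u w (ℕₚ.<-trans a<b b<c)
  ... | inj₁ a<b | inj₂ (refl , _) = ≤ₗ-< a c u w a<b
  ... | inj₂ (refl , _) | inj₁ b<c = ≤ₗ-< a c u w b<c
  ... | inj₂ (refl , u≤v) | inj₂ (refl , v≤w) = ≤ₗ-≡ a u w (≤ₗ-trans u v w u≤v v≤w)

  ≤ₗ-antisym : {d : ℕ} (v w : Col N d) → v ≤ₗ w → w ≤ₗ v → v ≡ w
  ≤ₗ-antisym [] [] _ _ = refl
  ≤ₗ-antisym (a ∷ v) (b ∷ w) v≤w w≤v with ≤ₗ-∷⁻ a b v w v≤w | ≤ₗ-∷⁻ b a w v w≤v
  ... | inj₁ a<b | inj₁ b<a = contradiction b<a (ℕₚ.<-asym a<b)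
  ... | inj₁ a<b | inj₂ (refl , _) = contradiction a<b (ℕₚ.<-irrefl refl)
  ... | inj₂ (refl , _) | inj₁ b<a = contradiction b<a (ℕₚ.<-irrefl refl)
  ... | inj₂ (refl , v≤w) | inj₂ (_ , w≤v) = cong (a ∷_) (≤ₗ-antisym v w v≤w w≤v)

  ≤ₗ-total : {d : ℕ} (v w : Col N d) → v ≤ₗ w ⊎ w ≤ₗ v
  ≤ₗ-total [] [] = inj₁ refl
  ≤ₗ-total (a ∷ v) (b ∷ w) with ℕₚ.<-cmp (toℕ a) (toℕ b)
  ... | tri< a<b _ _ = inj₁ (≤ₗ-< a b v w a<b)
  ... | tri> _ _ b<a = inj₂ (≤ₗ-< b a w v b<a)
  ... | tri≈ _ a≡b _ with toℕ-injective a≡b | ≤ₗ-total v w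
  ...   | refl | inj₁ v≤w = inj₁ (≤ₗ-≡ a v w v≤w)
  ...   | refl | inj₂ w≤v = inj₂ (≤ₗ-≡ a w v w≤v)

  -- Sorting by this order provides a representative in `Alex` of every full monomial, and
  -- antisymmetry makes it the only one.
  ≤ₗ-decTotalOrder : ℕ → DecTotalOrder 0ℓ 0ℓ 0ℓ
  ≤ₗ-decTotalOrder d = record
    { Carrier = Col N d
    ; _≈_ = _≡_
    ; _≤_ = _≤ₗ_
    ; isDecTotalOrder = record
      { isTotalOrder = record
        { isPartialOrder = record
          { isPreorder = record
            { isEquivalence = ≡.isEquivalence
            ; reflexive = λ { {v} refl → ≤ₗ-refl v }
            ; trans = λ {u} {v} {w} → ≤ₗ-trans u v w
            }
          ; antisym = λ {v} {w} → ≤ₗ-antisym v w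
          }
        ; total = ≤ₗ-total
        }
      ; _≟_ = _≟C_
      ; _≤?_ = λ v w → lexLeq v w Boolₚ.≟ true
      }
    }

  lexSorted⇒Linked : {d : ℕ} (S : Table N d) → lexSorted S ≡ true → Linked _≤ₗ_ S
  lexSorted⇒Linked [] e = []
  lexSorted⇒Linked (c ∷ []) e = [-]
  lexSorted⇒Linked (c ∷ c′ ∷ S) e =
    Boolₚ.∧-conicalˡ _ _ e ∷ lexSorted⇒Linked (c′ ∷ S) (Boolₚ.∧-conicalʳ (lexLeq c c′) _ e)

  Linked⇒lexSorted : {d : ℕ} {S : Table N d} → Linked _≤ₗ_ S → lexSorted S ≡ true
  Linked⇒lexSorted [] = refl
  Linked⇒lexSorted [-] = refl
  Linked⇒lexSorted (c≤c′ ∷ l) rewrite c≤c′ = Linked⇒lexSorted l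

sameMon-↭ : {N d : ℕ} (T : Monomial N d) {M M′ : Monomial N d} → M ↭ M′ → sameMon T M ≡ sameMon T M′
sameMon-↭ T {M} {M′} M↭M′ with sameMon T M in e | sameMon T M′ in e′
... | true | true = refl
... | false | false = refl
... | true | false = contradiction (≡.trans (sym e′) (↭⇒sameMon (trans (sameMon⇒↭ T M e) M↭M′))) λ ()
... | false | true = contradiction (≡.trans (sym e) (↭⇒sameMon (trans (sameMon⇒↭ T M′ e′) (↭-sym M↭M′)))) λ ()

coeff-↭ : {N d : ℕ} (P : Poly N d) {M M′ : Monomial N d} → M ↭ M′ → coeff P M ≡ coeff P M′
coeff-↭ P M↭M′ = Σℚ.big-cong P (λ t → cong (if_then proj₁ t else 0ℚ) (sameMon-↭ (proj₂ t) M↭M′))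

balancedᵇ : {k d : ℕ} → ℕ → Table k d → Bool
balancedᵇ {k} {d} n S =
  allB (λ i → allB (λ c → countB (λ x → ⌊ x ≟F c ⌋) (row S i) ≡ᵇ n) (allFin k)) (allFin d)

balancedᵇ⇒Balanced : {k d n : ℕ} (S : Table k d) → balancedᵇ n S ≡ true → Balanced n S
balancedᵇ⇒Balanced {k} {d} S e i c =
  ≡ᵇ-true⁻ (allB-true⁻ _ (allFin k) (allB-true⁻ _ (allFin d) e (∈-allFin i)) (∈-allFin c))

Balanced⇒balancedᵇ : {k d n : ℕ} (S : Table k d) → Balanced n S → balancedᵇ n S ≡ true
Balanced⇒balancedᵇ {k} {d} S b =
  allB-true⁺ _ (allFin d) (λ {i} _ → allB-true⁺ _ (allFin k) (λ {c} _ → ≡ᵇ-true⁺ (b i c)))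

full? : {k d : ℕ} (n : ℕ) (M : Monomial k d) → Dec (Full n M)
full? {k} n M = (length M ℕ.≟ k ℕ.* n) ×-dec
  all? (λ i → all? (λ c → countB (λ x → ⌊ x ≟F c ⌋) (row M i) ℕ.≟ n))

coeff-rhsPoly : {k d : ℕ} (n : ℕ) (M : Monomial k d) →
  coeff (rhsPoly d k n) M ≡ Σℚ.big (allLists (allCols k d) (k ℕ.* n)) (λ S →
    if balancedᵇ n S ∧ lexSorted S then (if sameMon S M then evalUnit (Delta n S) else 0ℚ) else 0ℚ)
coeff-rhsPoly {k} {d} n M = ≡.trans (Σℚ.big-map _ (Alex d k n) _)
  (Σℚ.big-filterᵇ _ (allLists (allCols k d) (k ℕ.* n)) _)

module _ {k d : ℕ} (even : 2 ∣ suc d) (n : ℕ) (M : Monomial k (suc d)) where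

  private
    module O = DecTotalOrder (≤ₗ-decTotalOrder {k} (suc d))
    open Sort (≤ₗ-decTotalOrder {k} (suc d)) using (sort; sort-↭; sort-↗)

    term : Table k (suc d) → ℚ
    term S = if balancedᵇ n S ∧ lexSorted S then (if sameMon S M then evalUnit (Delta n S) else 0ℚ) else 0ℚ

    term-vanishes : ∀ S → (balancedᵇ n S ≡ true → lexSorted S ≡ true → sameMon S M ≡ true → ∀ {X : Set} → X) → term S ≡ 0ℚ
    term-vanishes S absurd with balancedᵇ n S | lexSorted S | sameMon S M
    ... | false | _ | _ = refl
    ... | true | false | _ = refl
    ... | true | true | false = refl
    ... | true | true | true = absurd refl refl refl

    term-¬Full : ¬ Full n M → ∀ S → length S ≡ k ℕ.* n → term S ≡ 0ℚ
    term-¬Full ¬full S len = term-vanishes S (λ b _ same →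
      contradiction (Full-↭ (sameMon⇒↭ S M same) (len , balancedᵇ⇒Balanced S b)) ¬full)

    term-Full : Full n M → ∀ S → term S ≡
      (if ⌊ Listₚ.≡-dec _≟C_ (sort M) S ⌋ then coeff (hyperdet (suc d) k ^P n) M else 0ℚ)
    term-Full full S with Listₚ.≡-dec _≟C_ (sort M) S
    -- Two sorted rearrangements of the same monomial are equal.
    ... | no ≢ = term-vanishes S (λ _ sorted same → contradiction
          (≋⇒≡ (↗↭↗⇒≋ O.totalOrder (sort-↗ M) (lexSorted⇒Linked S sorted)
            (↭⇒↭ₛ (trans (sort-↭ M) (↭-sym (sameMon⇒↭ S M same)))))) ≢)
    -- All tests succeed at `sort M`, and the coefficient of the power does not distinguish `sort M`
    -- from `M`.
    ... | yes refl
      rewrite Balanced⇒balancedᵇ (sort M) (proj₂ (Full-↭ (↭-sym (sort-↭ M)) full))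
            | Linked⇒lexSorted (sort-↗ M) | ↭⇒sameMon (sort-↭ M) =
      ≡.trans (sym (coeff-balanced even n (sort M) (proj₂ (Full-↭ (↭-sym (sort-↭ M)) full))))
        (coeff-↭ (hyperdet (suc d) k ^P n) (sort-↭ M))

  -- Off the full monomials both coefficients are zero. At a full one, the right-hand sum reduces to
  -- the single table `sort M`.
  coeff-hyperdet^-rhsPoly : coeff (hyperdet (suc d) k ^P n) M ≡ coeff (rhsPoly (suc d) k n) M
  coeff-hyperdet^-rhsPoly with full? n M
  ... | no ¬full = ≡.trans (coeff-¬Full even n M ¬full) (sym (≡.trans (coeff-rhsPoly n M)
          (≡.trans (big-cong-length (allCols k (suc d)) (k ℕ.* n) (term-¬Full ¬full))
            (Σℚ.big-ε (allLists (allCols k (suc d)) (k ℕ.* n))))))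
  ... | yes full = sym (≡.trans (coeff-rhsPoly n M)
          (≡.trans (Σℚ.big-cong (allLists (allCols k (suc d)) (k ℕ.* n)) (term-Full full))
            (Σℚ.big-single (Listₚ.≡-dec _≟C_) (sort M) (allLists (allCols k (suc d)) (k ℕ.* n)) _
              -- `sort M` has length `k ℕ.* n`, so it is listed exactly once among the candidate
              -- tables.
              (≡.subst (λ m → countB (λ S → ⌊ Listₚ.≡-dec _≟C_ (sort M) S ⌋) (allLists (allCols k (suc d)) m) ≡ 1)
                (≡.trans (↭-length (sort-↭ M)) (proj₁ full))
                (once-allLists _≟C_ (allCols k (suc d)) (once-allCols k (suc d)) (sort M))))))

-- Latin hypercubes

length-allFin : ∀ n → length (allFin n) ≡ n
length-allFin n = Listₚ.length-tabulate {n = n} (λ i → i)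

big-allVecs-const : (k d m : ℕ) → Σℕ.big (allVecs (allFin k) d) (λ _ → m) ≡ k ^ d ℕ.* m
big-allVecs-const k zero m = refl
big-allVecs-const k (suc d) m = begin
  Σℕ.big (allVecs (allFin k) (suc d)) (λ _ → m)
    ≡⟨ Σℕ.big-allVecs-suc (allFin k) d (λ _ → m) ⟩
  Σℕ.big (allFin k) (λ _ → Σℕ.big (allVecs (allFin k) d) (λ _ → m))
    ≡⟨ Σℕ.big-cong (allFin k) (λ _ → big-allVecs-const k d m) ⟩
  Σℕ.big (allFin k) (λ _ → k ^ d ℕ.* m)
    ≡⟨ ≡.trans (big-const (allFin k) (k ^ d ℕ.* m)) (cong (ℕ._* (k ^ d ℕ.* m)) (length-allFin k)) ⟩
  k ℕ.* (k ^ d ℕ.* m)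
    ≡⟨ sym (ℕₚ.*-assoc k (k ^ d) m) ⟩
  k ^ suc d ℕ.* m ∎

-- Fixing one coordinate of a cell leaves the other `d` free, so each slice has k^d cells. This is
-- the number of factors in the power.
Balanced-cells : (k d : ℕ) → Balanced (k ^ d) (cells k (suc d))
Balanced-cells k d i c = ≡.trans (count-map (λ b → ⌊ b ≟F c ⌋) (λ v → lookup v i) (cells k (suc d)))
  (≡.trans (count-big (λ v → ⌊ lookup v i ≟F c ⌋) (cells k (suc d))) (go d i))
  where
  go : ∀ d i → Σℕ.big (cells k (suc d)) (λ v → bit ⌊ lookup v i ≟F c ⌋) ≡ k ^ d
  go d zero = begin
    Σℕ.big (cells k (suc d)) (λ v → bit ⌊ lookup v zero ≟F c ⌋)
      ≡⟨ Σℕ.big-allVecs-suc (allFin k) d (λ v → bit ⌊ lookup v zero ≟F c ⌋) ⟩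
    Σℕ.big (allFin k) (λ a → Σℕ.big (cells k d) (λ v → bit ⌊ a ≟F c ⌋))
      ≡⟨ Σℕ.big-swap (allFin k) (cells k d) (λ a _ → bit ⌊ a ≟F c ⌋) ⟩
    Σℕ.big (cells k d) (λ v → Σℕ.big (allFin k) (λ a → bit ⌊ a ≟F c ⌋))
      ≡⟨ Σℕ.big-cong (cells k d) (λ _ → ≡.trans (Σℕ.big-cong (allFin k) (λ a → cong bit (⌊⌋-sym _≟F_ a c)))
           (Σℕ.big-single _≟F_ c (allFin k) (λ _ → 1) (once-allFin k c))) ⟩
    Σℕ.big (cells k d) (λ _ → 1)
      ≡⟨ ≡.trans (big-allVecs-const k d 1) (ℕₚ.*-identityʳ (k ^ d)) ⟩
    k ^ d ∎
  go (suc d) (suc i) = begin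
    Σℕ.big (cells k (suc (suc d))) (λ v → bit ⌊ lookup v (suc i) ≟F c ⌋)
      ≡⟨ Σℕ.big-allVecs-suc (allFin k) (suc d) (λ v → bit ⌊ lookup v (suc i) ≟F c ⌋) ⟩
    Σℕ.big (allFin k) (λ a → Σℕ.big (cells k (suc d)) (λ v → bit ⌊ lookup v i ≟F c ⌋))
      ≡⟨ Σℕ.big-cong (allFin k) (λ _ → go d i) ⟩
    Σℕ.big (allFin k) (λ _ → k ^ d)
      ≡⟨ ≡.trans (big-const (allFin k) (k ^ d)) (cong (ℕ._* k ^ d) (length-allFin k)) ⟩
    k ^ suc d ∎

normT-cells : (k d : ℕ) → normT (cells k d) ≡ 1
normT-cells k d = ≡.trans (Πℕ.big-cong (allCols k d) (λ c → cong ℕ._! (once-allCols k d c))) (Πℕ.big-ε (allCols k d))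

map-filterᵇ-map₁ : {E F : Set} (h : A → B) (p : B → Bool) (g : E → F) (z : List (A × E)) →
  map (λ q → g (proj₂ q)) (List.filterᵇ (λ q → p (proj₁ q)) (map (map₁ h) z)) ≡
  map (λ q → g (proj₂ q)) (List.filterᵇ (λ q → p (h (proj₁ q))) z)
map-filterᵇ-map₁ h p g [] = refl
map-filterᵇ-map₁ h p g ((a , e) ∷ z) with p (h a)
... | true = cong (g e ∷_) (map-filterᵇ-map₁ h p g z)
... | false = map-filterᵇ-map₁ h p g z

-- Row `ℓ` of the table of all cells lists their ℓ-th coordinates, so the positions of the letter
-- `j` form the slice in direction `ℓ` at `j`, in lexicographic order.
sgnWord-slices : {k d K : ℕ} (x : List (Fin K)) (ℓ : Fin d) →
  sgnWord (row (cells k d) ℓ) x ≡ Πℤ.big (allFin k) (λ j → psgn (slice {k} {d} x ℓ j))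
sgnWord-slices {k} {d} x ℓ = Πℤ.big-cong (allFin k) (λ j → cong psgn (≡.trans
  (cong (λ z → map (λ p → toℕ (proj₂ p)) (List.filterᵇ (λ p → ⌊ proj₁ p ≟F j ⌋) z)) (zip-mapˡ (λ v → lookup v ℓ) (cells k d) x))
  (map-filterᵇ-map₁ (λ v → lookup v ℓ) (λ b → ⌊ b ≟F j ⌋) toℕ (zip (cells k d) x))))

-- A labelling of the cells is a map L. Those that are not Latin hypercubes have a slice of sign
-- zero, so the sum may run over all labellings.
AT-sgnWord : (k d : ℕ) → AT (suc d) k ≡
  Σℤ.big (allLists (allFin (k ^ d)) (length (cells k (suc d)))) (λ x →
    Πℤ.big (allFin (suc d)) (λ ℓ → sgnWord (row (cells k (suc d)) ℓ) x))
AT-sgnWord k d = ≡.trans (Σℤ.big-filterᵇ _ words _) (Σℤ.big-cong words latin)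
  where
  words = allLists (allFin (k ^ d)) (length (cells k (suc d)))
  latin : ∀ x → (if isLatin {k} {suc d} x then sgnLatin {k} {suc d} x else + 0) ≡
    Πℤ.big (allFin (suc d)) (λ ℓ → sgnWord (row (cells k (suc d)) ℓ) x)
  latin x = begin
    (if isLatin {k} {suc d} x then sgnLatin {k} {suc d} x else + 0)
      ≡⟨ sym (Π-if (allSlices {k} {suc d} x) isPerm signW) ⟩
    Πℤ.big (allSlices {k} {suc d} x) psgn
      ≡⟨ Πℤ.big-concatMap (λ ℓ → map (slice {k} x ℓ) (allFin k)) (allFin (suc d)) psgn ⟩
    Πℤ.big (allFin (suc d)) (λ ℓ → Πℤ.big (map (slice {k} x ℓ) (allFin k)) psgn)
      ≡⟨ Πℤ.big-cong (allFin (suc d)) (λ ℓ → ≡.trans (Πℤ.big-map (slice {k} x ℓ) (allFin k) psgn) (sym (sgnWord-slices {k} x ℓ))) ⟩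
    Πℤ.big (allFin (suc d)) (λ ℓ → sgnWord (row (cells k (suc d)) ℓ) x) ∎

σ-cases : ∀ m → σ m ≡ + 1 ⊎ σ m ≡ ℤ.-1ℤ
σ-cases zero = inj₁ refl
σ-cases (suc m) with σ-cases m
... | inj₁ e = inj₂ (cong (ℤ.-1ℤ ℤ.*_) e)
... | inj₂ e = inj₁ (cong (ℤ.-1ℤ ℤ.*_) e)

signT-cases : {k d : ℕ} (S : Table k d) → signT S ≡ + 1 ⊎ signT S ≡ ℤ.-1ℤ
signT-cases {d = d} S = ≡.subst (λ t → t ≡ + 1 ⊎ t ≡ ℤ.-1ℤ) (sym (Π-signW (allFin d) (λ i → finsToℕ (row S i))))
  (σ-cases (Σℕ.big (allFin d) (λ i → inversions (finsToℕ (row S i)))))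

evalUnit-cells : (k d : ℕ) → evalUnit (Delta (k ^ d) (cells k (suc d))) ≡ ℤtoℚ (signT (cells k (suc d)) ℤ.* AT (suc d) k)
evalUnit-cells k d = begin
  evalUnit (Delta (k ^ d) S)
    ≡⟨ evalUnit-Delta (k ^ d) S ⟩
  Σℚ.big words (λ x → ℤtoℚ (signT S ℤ.* word x)) ℚ.* recipℕ (normT S)
    ≡⟨ cong (λ m → Σℚ.big words (λ x → ℤtoℚ (signT S ℤ.* word x)) ℚ.* recipℕ m) (normT-cells k (suc d)) ⟩
  Σℚ.big words (λ x → ℤtoℚ (signT S ℤ.* word x)) ℚ.* 1ℚ
    ≡⟨ ℚₚ.*-identityʳ (Σℚ.big words (λ x → ℤtoℚ (signT S ℤ.* word x))) ⟩
  Σℚ.big words (λ x → ℤtoℚ (signT S ℤ.* word x))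
    ≡⟨ sym (Σℤ.big-hom (λ t → ℤtoℚ (signT S ℤ.* t)) (cong ℤtoℚ (ℤₚ.*-zeroʳ (signT S)))
         (λ a b → ≡.trans (cong ℤtoℚ (ℤₚ.*-distribˡ-+ (signT S) a b)) (ℤtoℚ-+ (signT S ℤ.* a) (signT S ℤ.* b))) words word) ⟩
  ℤtoℚ (signT S ℤ.* Σℤ.big words word)
    ≡⟨ cong (λ t → ℤtoℚ (signT S ℤ.* t)) (sym (AT-sgnWord k d)) ⟩
  ℤtoℚ (signT S ℤ.* AT (suc d) k) ∎
  where
  S = cells k (suc d)
  words = allLists (allFin (k ^ d)) (length S)
  word : List (Fin (k ^ d)) → ℤ
  word x = Πℤ.big (allFin (suc d)) (λ ℓ → sgnWord (row S ℓ) x)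

-- The sign is `signT` of the table of all cells. These columns are distinct, so their norm is 1 and
-- no denominator remains.
coeff-fullMonomial : {d : ℕ} → 2 ∣ suc d → (k : ℕ) →
  coeff (hyperdet (suc d) k ^P (k ^ d)) (fullMonomial k (suc d)) ≡ ℤtoℚ (AT (suc d) k) ⊎
  coeff (hyperdet (suc d) k ^P (k ^ d)) (fullMonomial k (suc d)) ≡ ℚ.- ℤtoℚ (AT (suc d) k)
coeff-fullMonomial {d} even k with signT-cases (cells k (suc d))
... | inj₁ e = inj₁ (≡.trans value (cong ℤtoℚ (≡.trans (cong (ℤ._* AT (suc d) k) e) (ℤₚ.*-identityˡ (AT (suc d) k)))))
  where value = ≡.trans (coeff-balanced even (k ^ d) (cells k (suc d)) (Balanced-cells k d)) (evalUnit-cells k d)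
... | inj₂ e = inj₂ (≡.trans value (≡.trans (cong (λ t → ℤtoℚ (t ℤ.* AT (suc d) k)) e)
        (≡.trans (ℤtoℚ-* ℤ.-1ℤ (AT (suc d) k))
          (≡.trans (sym (ℚₚ.neg-distribˡ-* 1ℚ (ℤtoℚ (AT (suc d) k)))) (cong ℚ.-_ (ℚₚ.*-identityˡ (ℤtoℚ (AT (suc d) k))))))))
  where value = ≡.trans (coeff-balanced even (k ^ d) (cells k (suc d)) (Balanced-cells k d)) (evalUnit-cells k d)

mainTheorem14 : (d k : ℕ) → 2 ≤ d → 2 ∣ d → 1 ≤ k →
    ((n : ℕ) → 1 ≤ n → (M : Monomial k d) →
    coeff (hyperdet d k ^P n) M ≡ coeff (rhsPoly d k n) M)
    × ((coeff (hyperdet d k ^P (k ^ (d ∸ 1))) (fullMonomial k d) ≡ ℤtoℚ (AT d k))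
    ⊎ (coeff (hyperdet d k ^P (k ^ (d ∸ 1))) (fullMonomial k d) ≡ - ℤtoℚ (AT d k)))
mainTheorem14 (suc d) k _ even _ = (λ n _ M → coeff-hyperdet^-rhsPoly even n M) , coeff-fullMonomial even k
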